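{- Every point of the interval $[m,M]$ is an accumulation point of $(b_n)_{n\ge1}$, where $m=\inf\{b_n:n\ge1\}$ and $M=\sup\{b_n:n\ge1\}$. In particular $(b_n)_{n\ge1}$ is dense in $[m,M]$ and its set of accumulation points is exactly $[m,M]$.
   Context: Fix integers $p\ge 3$ and $2\le s<p$, and a set $A\subset\{0,1,\dots,p-1\}$ with $\#A=s$. Let $h:\{0,1,\dots,s-1\}\to A$ be the unique strictly increasing bijection. For a positive integer $n$ with base-$s$ expansion $n=\sum_{i=0}^k\varepsilon_i s^i$ ($\varepsilon_i\in\{0,\dots,s-1\}$, $\varepsilon_k\ne 0$), put $a_n=\sum_{i=0}^k h(\varepsilon_i)p^i$. Let $b_n=a_n/n^{\log_s p}$ for $n\ge1$. An accumulation point of $(b_n)$ is a limit of $b_{n_k}$ along a strictly increasing sequence of indices $(n_k)$. -}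

module Defs where

open import Data.Nat.Base as ℕ using (ℕ; zero; suc; z≤n; s≤s; NonZero)
import Data.Nat.Properties as ℕ
open import Data.Nat.DivMod using (_/_; _%_; m≡m%n+[m/n]*n; m%n<n; m/n<m; m≥n⇒m/n>0)
open import Data.Nat.Induction using (<-wellFounded)
open import Induction.WellFounded using (Acc; acc)
open import Data.Integer.Base as ℤ using (+_; -[1+_]; +≤+; +<+; -≤+)
import Data.Integer.Properties as ℤ
open import Data.Rational.Base as ℚ
  using (ℚ; mkℚ; 0ℚ; 1ℚ; _+_; _-_; _*_; -_; _≤_; _<_; 1/_; positive; nonNegative; toℚᵘ)
open import Data.Rational.Properties
open import Data.Rational.Solver using (module +-*-Solver)
open import Data.Rational.Unnormalised.Base as ℚᵘ using (mkℚᵘ)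
import Data.Rational.Unnormalised.Properties as ℚᵘ
open import Algebra.Bundles using (CommutativeRing)
import Algebra.Properties.Semiring.Exp as Exp
open import Algebra.Properties.CommutativeMonoid.Sum ℕ.+-0-commutativeMonoid using (sum-syntax; sum-cong-≋)
open import Algebra.Properties.Semiring.Sum ℕ.+-*-semiring using (*-distribʳ-sum)
open import Data.Fin.Base as Fin using (Fin; zero; suc; toℕ; fromℕ; fromℕ<)
import Data.Fin.Properties as Fin
open import Data.Fin.Subset using (Subset; _∈_)
open import Data.Product.Base using (Σ-syntax; ∃; ∃₂; ∃-syntax; _×_; _,_; proj₁; proj₂)
open import Data.Sum.Base using (_⊎_; inj₁; inj₂)
open import Function.Base using (_∘_)
open import Function.Bundles using (_⤖_; Bijection)
open import Relation.Binary.Definitions using (tri<; tri≈; tri>)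
open import Relation.Binary.Core using (_Preserves_⟶_)
open import Relation.Binary.PropositionalEquality
  using (_≡_; _≢_; refl; sym; trans; cong; cong₂; subst; subst₂; module ≡-Reasoning)
open import Relation.Nullary using (¬_; Dec; yes; no; contradiction)

open Exp (CommutativeRing.semiring +-*-commutativeRing) using (_^_; ^-assocʳ; ^-homo-*)

-- frac i j is i/(j+1): shifting the denominator keeps it positive.  Opaque
-- because unfolding it normalises a gcd on open terms.
opaque
  frac : ℕ → ℕ → ℚ
  frac i j = + i ℚ./ suc j

  frac-def : ∀ i j → frac i j ≡ + i ℚ./ suc j
  frac-def i j = refl

  private
    toℚᵘ-frac : ∀ i j → toℚᵘ (frac i j) ℚᵘ.≃ mkℚᵘ (+ i) j
    toℚᵘ-frac i j = toℚᵘ-fromℚᵘ (mkℚᵘ (+ i) j)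

private
  toℚᵘ-frac˘ : ∀ i j → mkℚᵘ (+ i) j ℚᵘ.≃ toℚᵘ (frac i j)
  toℚᵘ-frac˘ i j = ℚᵘ.≃-sym {toℚᵘ (frac i j)} {mkℚᵘ (+ i) j} (toℚᵘ-frac i j)

frac-num-denom : ∀ q {i} → ℚ.↥ q ≡ + i → q ≡ frac i (ℚ.denominator-1 q)
frac-num-denom q@(mkℚ _ _ _) {i} refl = trans (sym (↥p/↧p≡p q)) (sym (frac-def i (ℚ.denominator-1 q)))

frac-mono-≤ : ∀ {i j k l} → i ℕ.* suc l ℕ.≤ k ℕ.* suc j → frac i j ≤ frac k l
frac-mono-≤ {i} {j} {k} {l} le = toℚᵘ-cancel-≤
  (ℚᵘ.≤-respˡ-≃ (toℚᵘ-frac˘ i j)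
  (ℚᵘ.≤-respʳ-≃ (toℚᵘ-frac˘ k l)
  (ℚᵘ.*≤* (subst₂ ℤ._≤_ (ℤ.pos-* i (suc l)) (ℤ.pos-* k (suc j)) (+≤+ le)))))

frac-mono-< : ∀ {i j k l} → i ℕ.* suc l ℕ.< k ℕ.* suc j → frac i j < frac k l
frac-mono-< {i} {j} {k} {l} lt = toℚᵘ-cancel-<
  (ℚᵘ.<-respˡ-≃ (toℚᵘ-frac˘ i j)
  (ℚᵘ.<-respʳ-≃ (toℚᵘ-frac˘ k l)
  (ℚᵘ.*<* (subst₂ ℤ._<_ (ℤ.pos-* i (suc l)) (ℤ.pos-* k (suc j)) (+<+ lt)))))

frac-cancel-< : ∀ {i j k l} → frac i j < frac k l → i ℕ.* suc l ℕ.< k ℕ.* suc j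
frac-cancel-< {i} {j} {k} {l} lt
  with ℚᵘ.<-respˡ-≃ (toℚᵘ-frac i j) (ℚᵘ.<-respʳ-≃ (toℚᵘ-frac k l) (toℚᵘ-mono-< lt))
... | ℚᵘ.*<* lt′
  with subst₂ ℤ._<_ (sym (ℤ.pos-* i (suc l))) (sym (ℤ.pos-* k (suc j))) lt′
... | +<+ lt″ = lt″

frac-zero : ∀ j → frac 0 j ≡ 0ℚ
frac-zero j = trans (frac-def 0 j) (0/n≡0 (suc j))

ι : ℕ → ℚ
ι n = frac n 0

ι-zero : ι 0 ≡ 0ℚ
ι-zero = frac-zero 0

ι-one : ι 1 ≡ 1ℚ
ι-one = frac-def 1 0

ι-mono-≤ : ∀ {m n} → m ℕ.≤ n → ι m ≤ ι n
ι-mono-≤ le = frac-mono-≤ (ℕ.*-monoˡ-≤ 1 le)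

0≤ι : ∀ n → 0ℚ ≤ ι n
0≤ι n = subst (_≤ ι n) ι-zero (ι-mono-≤ z≤n)

1≤ι : ∀ n .{{_ : NonZero n}} → 1ℚ ≤ ι n
1≤ι n = subst (_≤ ι n) ι-one (ι-mono-≤ (ℕ.>-nonZero⁻¹ n))

ι-suc : ∀ n → ι (suc n) ≡ 1ℚ + ι n
ι-suc n = toℚᵘ-injective (begin
  toℚᵘ (ι (suc n))             ≈⟨ toℚᵘ-frac (suc n) 0 ⟩
  mkℚᵘ (+ suc n) 0             ≈⟨ ℚᵘ.*≡* (cong (λ z → (ℤ.1ℤ ℤ.+ z) ℤ.* ℤ.1ℤ) (ℤ.*-identityʳ (+ n))) ⟨
  toℚᵘ 1ℚ ℚᵘ.+ mkℚᵘ (+ n) 0    ≈⟨ ℚᵘ.+-congʳ (toℚᵘ 1ℚ) (toℚᵘ-frac n 0) ⟨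
  toℚᵘ 1ℚ ℚᵘ.+ toℚᵘ (ι n)      ≈⟨ toℚᵘ-homo-+ 1ℚ (ι n) ⟨
  toℚᵘ (1ℚ + ι n)              ∎)
  where open ℚᵘ.≃-Reasoning

archimedean : ∀ q → ∃[ n ] q ≤ ι n
archimedean (mkℚ -[1+ k ] d c) = 0 , ≤-trans (toℚᵘ-cancel-≤ (ℚᵘ.*≤* -≤+)) (0≤ι 0)
archimedean q@(mkℚ (+ k) d _) = k , ≤-trans (≤-reflexive (frac-num-denom q refl))
  (frac-mono-≤ (ℕ.*-monoʳ-≤ k (s≤s z≤n)))

recip : ∀ d → 0ℚ < d → ℚ
recip d 0<d = (1/ d) {{pos⇒nonZero d {{positive 0<d}}}}

0<recip : ∀ d (0<d : 0ℚ < d) → 0ℚ < recip d 0<d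
0<recip d 0<d = positive⁻¹ (recip d 0<d) {{1/pos⇒pos d {{positive 0<d}}}}

recip-cancel : ∀ q d (0<d : 0ℚ < d) → q * recip d 0<d * d ≡ q
recip-cancel q d 0<d = trans (*-assoc q (recip d 0<d) d)
  (trans (cong (q *_) (*-inverseˡ d {{pos⇒nonZero d {{positive 0<d}}}})) (*-identityʳ q))

archimedean-* : ∀ q {d} → 0ℚ < d → ∃[ n ] q ≤ ι (suc n) * d
archimedean-* q {d} 0<d = n , (begin
  q                     ≡⟨ recip-cancel q d 0<d ⟨
  q * recip d 0<d * d   ≤⟨ *-monoʳ-≤-nonNeg d {{nonNegative (<⇒≤ 0<d)}}
                             (≤-trans (proj₂ (archimedean (q * recip d 0<d))) (ι-mono-≤ (ℕ.n≤1+n n))) ⟩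
  ι (suc n) * d         ∎)
  where
  open ≤-Reasoning
  n = proj₁ (archimedean (q * recip d 0<d))

*-mono-≤-nonNeg : ∀ {w x y z} → 0ℚ ≤ w → 0ℚ ≤ y → w ≤ x → y ≤ z → w * y ≤ x * z
*-mono-≤-nonNeg {w} {x} {y} {z} 0≤w 0≤y w≤x y≤z = ≤-trans
  (*-monoʳ-≤-nonNeg y {{nonNegative 0≤y}} w≤x)
  (*-monoˡ-≤-nonNeg x {{nonNegative (≤-trans 0≤w w≤x)}} y≤z)

^-nonNeg : ∀ {q} k → 0ℚ ≤ q → 0ℚ ≤ q ^ k
^-nonNeg zero    0≤q = <⇒≤ (positive⁻¹ 1ℚ)
^-nonNeg (suc k) 0≤q = *-mono-≤-nonNeg ≤-refl ≤-refl 0≤q (^-nonNeg k 0≤q)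

^-mono-≤ : ∀ {q r} k → 0ℚ ≤ q → q ≤ r → q ^ k ≤ r ^ k
^-mono-≤ zero    0≤q q≤r = ≤-refl
^-mono-≤ (suc k) 0≤q q≤r = *-mono-≤-nonNeg 0≤q (^-nonNeg k 0≤q) q≤r (^-mono-≤ k 0≤q q≤r)

^-pos : ∀ {q} k → 0ℚ < q → 0ℚ < q ^ k
^-pos zero    0<q = positive⁻¹ 1ℚ
^-pos {q} (suc k) 0<q =
  subst (_< q * q ^ k) (*-zeroʳ q) (*-monoʳ-<-pos q {{positive 0<q}} (^-pos k 0<q))

^-mono-< : ∀ {q r} k → 0ℚ ≤ q → q < r → q ^ suc k < r ^ suc k
^-mono-< {q} {r} k 0≤q q<r = ≤-<-trans
  (*-monoˡ-≤-nonNeg q {{nonNegative 0≤q}} (^-mono-≤ k 0≤q (<⇒≤ q<r)))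
  (*-monoˡ-<-pos (r ^ k) {{positive (^-pos k (≤-<-trans 0≤q q<r))}} q<r)

^-mono-exponent : ∀ {q i k} → 1ℚ ≤ q → i ℕ.≤ k → q ^ i ≤ q ^ k
^-mono-exponent {q} {i} {k} 1≤q i≤k = subst (λ e → q ^ i ≤ q ^ e) (ℕ.m+[n∸m]≡n i≤k) (begin
  q ^ i                       ≡⟨ *-identityʳ _ ⟨
  q ^ i * 1ℚ                  ≤⟨ *-monoˡ-≤-nonNeg (q ^ i) {{nonNegative (^-nonNeg i 0≤q)}} (1≤^ (k ℕ.∸ i)) ⟩
  q ^ i * q ^ (k ℕ.∸ i)       ≡⟨ ^-homo-* q i (k ℕ.∸ i) ⟨
  q ^ (i ℕ.+ (k ℕ.∸ i))       ∎)
  where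
  open ≤-Reasoning
  0≤q = ≤-trans (<⇒≤ (positive⁻¹ 1ℚ)) 1≤q
  1≤^ : ∀ m → 1ℚ ≤ q ^ m
  1≤^ zero    = ≤-refl
  1≤^ (suc m) = *-mono-≤-nonNeg (<⇒≤ (positive⁻¹ 1ℚ)) (<⇒≤ (positive⁻¹ 1ℚ)) 1≤q (1≤^ m)

bernoulli : ∀ {q d} → 0ℚ ≤ q → 0ℚ ≤ d → ∀ k → q ^ k * (q + ι k * d) ≤ (q + d) ^ k * q
bernoulli {q} {d} 0≤q 0≤d zero = ≤-reflexive
  (trans (cong (λ z → 1ℚ * (q + z * d)) ι-zero)
         (solve 2 (λ q d → con 1ℚ :* (q :+ con 0ℚ :* d) := con 1ℚ :* q) refl q d))
  where open +-*-Solver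
bernoulli {q} {d} 0≤q 0≤d (suc k) = begin
  q ^ suc k * (q + ι (suc k) * d)
    ≡⟨ cong (λ z → q ^ suc k * (q + z * d)) (ι-suc k) ⟩
  q * q ^ k * (q + (1ℚ + ι k) * d)
    ≡⟨ solve 4 (λ q d x n → q :* x :* (q :+ (con 1ℚ :+ n) :* d)
                         := q :* (x :* (q :+ n :* d)) :+ q :* d :* x) refl q d (q ^ k) (ι k) ⟩
  q * (q ^ k * (q + ι k * d)) + q * d * q ^ k
    ≤⟨ +-mono-≤ (*-monoˡ-≤-nonNeg q (bernoulli 0≤q 0≤d k))
                (*-mono-≤-nonNeg 0≤qd (^-nonNeg k 0≤q) ≤-refl (^-mono-≤ k 0≤q q≤q+d)) ⟩
  q * ((q + d) ^ k * q) + q * d * (q + d) ^ k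
    ≡⟨ solve 3 (λ q d y → q :* (y :* q) :+ q :* d :* y := (q :+ d) :* y :* q) refl q d ((q + d) ^ k) ⟩
  (q + d) ^ suc k * q ∎
  where
  open ≤-Reasoning
  open +-*-Solver
  instance q-nonNeg = nonNegative 0≤q
  0≤qd = *-mono-≤-nonNeg {0ℚ} {q} {0ℚ} {d} ≤-refl ≤-refl 0≤q 0≤d
  q≤q+d = subst (_≤ q + d) (+-identityʳ q) (+-monoʳ-≤ q 0≤d)

power-gap : ∀ {q r} → 0ℚ < q → q < r → ∀ B → ∃[ k ] q ^ suc k * B ≤ r ^ suc k
power-gap {q} {r} 0<q q<r B = k , *-cancelʳ-≤-pos q {{positive 0<q}} (begin
  q ^ suc k * B * q                          ≡⟨ *-assoc (q ^ suc k) B q ⟩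
  q ^ suc k * (B * q)                        ≤⟨ *-monoˡ-≤-nonNeg (q ^ suc k) {{nonNegative (^-nonNeg (suc k) 0≤q)}} Bq≤ ⟩
  q ^ suc k * (q + ι (suc k) * d)            ≤⟨ bernoulli 0≤q (<⇒≤ 0<d) (suc k) ⟩
  (q + d) ^ suc k * q                        ≡⟨ cong (λ z → z ^ suc k * q) q+d≡r ⟩
  r ^ suc k * q                              ∎)
  where
  open ≤-Reasoning
  0≤q = <⇒≤ 0<q
  d = r - q
  q+d≡r : q + d ≡ r
  q+d≡r = solve 2 (λ q r → q :+ (r :- q) := r) refl q r where open +-*-Solver
  0<d : 0ℚ < d
  0<d = subst (_< d) (+-inverseʳ q) (+-monoˡ-< (- q) q<r)
  k = proj₁ (archimedean-* (B * q) 0<d)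
  Bq≤ : B * q ≤ q + ι (suc k) * d
  Bq≤ = ≤-trans (proj₂ (archimedean-* (B * q) 0<d))
    (subst (_≤ q + ι (suc k) * d) (+-identityˡ _) (+-monoˡ-≤ (ι (suc k) * d) 0≤q))

-- Lower x q means q < x and Upper x q means x < q.
record ℝ : Set₁ where
  field
    Lower Upper     : ℚ → Set
    lower-inhabited : ∃ Lower
    upper-inhabited : ∃ Upper
    lower-closed    : ∀ {q r} → q < r → Lower r → Lower q
    upper-closed    : ∀ {q r} → q < r → Upper q → Upper r
    lower-open      : ∀ {q} → Lower q → ∃[ r ] q < r × Lower r
    upper-open      : ∀ {r} → Upper r → ∃[ q ] q < r × Upper q
    disjoint        : ∀ {q} → Lower q → ¬ Upper q
    located         : ∀ {q r} → q < r → Lower q ⊎ Upper r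

open ℝ public

infix 4 _≤ᴿ_ _<ᴿ_ ∣_-_∣<_
infixl 6 _⊕_

_≤ᴿ_ : ℝ → ℝ → Set
x ≤ᴿ y = ∀ {q} → Lower x q → Lower y q

_<ᴿ_ : ℝ → ℝ → Set
x <ᴿ y = ∃[ q ] Upper x q × Lower y q

_⊕_ : ℝ → ℚ → ℝ
x ⊕ ε = record
  { Lower = λ q → Lower x (q - ε)
  ; Upper = λ q → Upper x (q - ε)
  ; lower-inhabited = let q , l = lower-inhabited x in q + ε , subst (Lower x) (sym (cancel q)) l
  ; upper-inhabited = let q , u = upper-inhabited x in q + ε , subst (Upper x) (sym (cancel q)) u
  ; lower-closed = lower-closed x ∘ +-monoˡ-< (- ε)
  ; upper-closed = upper-closed x ∘ +-monoˡ-< (- ε)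
  ; lower-open = λ {q} l → let r , q<r , l′ = lower-open x l in
      r + ε , subst (_< r + ε) (cancel′ q) (+-monoˡ-< ε q<r) , subst (Lower x) (sym (cancel r)) l′
  ; upper-open = λ {r} u → let q , q<r , u′ = upper-open x u in
      q + ε , subst (q + ε <_) (cancel′ r) (+-monoˡ-< ε q<r) , subst (Upper x) (sym (cancel q)) u′
  ; disjoint = disjoint x
  ; located = located x ∘ +-monoˡ-< (- ε)
  }
  where
  open +-*-Solver
  cancel : ∀ q → (q + ε) - ε ≡ q
  cancel q = solve 2 (λ q e → (q :+ e) :- e := q) refl q ε
  cancel′ : ∀ q → (q - ε) + ε ≡ q
  cancel′ q = solve 2 (λ q e → (q :- e) :+ e := q) refl q ε

-- |x - y| < ε, unfolded to x < y + ε and y < x + ε.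
∣_-_∣<_ : ℝ → ℝ → ℚ → Set
∣ x - y ∣< ε = x <ᴿ y ⊕ ε × y <ᴿ x ⊕ ε

-- The real number with the rationals in Below as lower bounds and those in
-- Above as upper bounds, provided these determine it.  The bounds need not
-- be strict, nor all of them be listed.
cut : (Below Above : ℚ → Set) → ∃ Below → ∃ Above →
      (∀ {q r} → Below q → Above r → q ≤ r) →
      (∀ {q r} → q < r → Below q ⊎ Above r) → ℝ
cut Below Above (b , below-b) (a , above-a) consistent loc = record
  { Lower = λ q → ∃[ r ] q < r × Below r
  ; Upper = λ r → ∃[ q ] q < r × Above q
  ; lower-inhabited = b - 1ℚ , b , subst (b - 1ℚ <_) (+-identityʳ b) (+-monoʳ-< b (negative⁻¹ (- 1ℚ))) , below-b
  ; upper-inhabited = a + 1ℚ , a , subst (_< a + 1ℚ) (+-identityʳ a) (+-monoʳ-< a (positive⁻¹ 1ℚ)) , above-a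
  ; lower-closed = λ { q<r (t , r<t , below) → t , <-trans q<r r<t , below }
  ; upper-closed = λ { q<r (t , t<q , above) → t , <-trans t<q q<r , above }
  ; lower-open = λ { (t , q<t , below) → let m , q<m , m<t = <-dense q<t in m , q<m , t , m<t , below }
  ; upper-open = λ { (t , t<r , above) → let m , t<m , m<r = <-dense t<r in m , m<r , t , t<m , above }
  ; disjoint = λ { (t , q<t , below) (v , v<q , above) →
      <-irrefl refl (<-≤-trans (<-trans v<q q<t) (consistent below above)) }
  ; located = λ q<r → let q′ , q<q′ , q′<r = <-dense q<r ; r′ , q′<r′ , r′<r = <-dense q′<r in
      strict q<q′ r′<r (loc q′<r′)
  }
  where
  strict : ∀ {q q′ r′ r} → q < q′ → r′ < r → Below q′ ⊎ Above r′ →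
           (∃[ t ] q < t × Below t) ⊎ (∃[ t ] t < r × Above t)
  strict q<q′ r′<r (inj₁ below) = inj₁ (_ , q<q′ , below)
  strict q<q′ r′<r (inj₂ above) = inj₂ (_ , r′<r , above)

lower<upper : ∀ x {q r} → Lower x q → Upper x r → q < r
lower<upper x {q} {r} l u with <-cmp q r
... | tri< q<r _ _  = q<r
... | tri≈ _ refl _ = contradiction u (disjoint x l)
... | tri> _ _ r<q  = contradiction u (disjoint x (lower-closed x r<q l))

private
  ^-cancelʳ-≤ : ∀ s i k → 2 ℕ.≤ s → s ℕ.^ i ℕ.≤ s ℕ.^ k → i ℕ.≤ k
  ^-cancelʳ-≤ s i k 2≤s le with i ℕ.≤? k
  ... | yes i≤k = i≤k
  ... | no  i≰k = contradiction le (ℕ.<⇒≱ (ℕ.^-monoʳ-< s 2≤s (ℕ.≰⇒> i≰k)))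

  n≤s^n : ∀ s n → 2 ℕ.≤ s → n ℕ.≤ s ℕ.^ n
  n≤s^n s zero    2≤s = z≤n
  n≤s^n s@(suc _) (suc n) 2≤s = begin
    suc n                     ≤⟨ ℕ.+-mono-≤ (ℕ.m^n>0 s n) (n≤s^n s n 2≤s) ⟩
    s ℕ.^ n ℕ.+ s ℕ.^ n       ≡⟨ cong (s ℕ.^ n ℕ.+_) (ℕ.+-identityʳ _) ⟨
    2 ℕ.* s ℕ.^ n             ≤⟨ ℕ.*-monoˡ-≤ (s ℕ.^ n) 2≤s ⟩
    s ℕ.* s ℕ.^ n             ∎
    where open ℕ.≤-Reasoning

-- i/j ≤ log_s p exactly when s^i ≤ p^j.
log : (s p : ℕ) → 2 ℕ.≤ s → 1 ℕ.≤ p → ℝ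
log s p 2≤s 1≤p = cut Below Above (0ℚ , 0≤log) (frac p 0 , p , 0 , ≤-refl , p≤s^p) consistent loc
  where
  Below Above : ℚ → Set
  Below q = ∃₂ λ i j → q ≤ frac i j × s ℕ.^ i ℕ.≤ p ℕ.^ suc j
  Above q = ∃₂ λ i j → frac i j ≤ q × p ℕ.^ suc j ℕ.≤ s ℕ.^ i

  0≤log : Below 0ℚ
  0≤log = 0 , 0 , ≤-reflexive (sym (frac-zero 0)) , ℕ.≤-trans 1≤p (ℕ.≤-reflexive (sym (ℕ.^-identityʳ p)))

  p≤s^p : p ℕ.^ 1 ℕ.≤ s ℕ.^ p
  p≤s^p = ℕ.≤-trans (ℕ.≤-reflexive (ℕ.^-identityʳ p)) (n≤s^n s p 2≤s)

  consistent : ∀ {q r} → Below q → Above r → q ≤ r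
  consistent (i , j , q≤ , s^i≤p^j) (k , l , ≤r , p^l≤s^k) =
    ≤-trans q≤ (≤-trans (frac-mono-≤ (^-cancelʳ-≤ s _ _ 2≤s (begin
      s ℕ.^ (i ℕ.* suc l)           ≡⟨ ℕ.^-*-assoc s i (suc l) ⟨
      (s ℕ.^ i) ℕ.^ suc l           ≤⟨ ℕ.^-monoˡ-≤ (suc l) s^i≤p^j ⟩
      (p ℕ.^ suc j) ℕ.^ suc l       ≡⟨ ℕ.^-*-assoc p (suc j) (suc l) ⟩
      p ℕ.^ (suc j ℕ.* suc l)       ≡⟨ cong (p ℕ.^_) (ℕ.*-comm (suc j) (suc l)) ⟩
      p ℕ.^ (suc l ℕ.* suc j)       ≡⟨ ℕ.^-*-assoc p (suc l) (suc j) ⟨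
      (p ℕ.^ suc l) ℕ.^ suc j       ≤⟨ ℕ.^-monoˡ-≤ (suc j) p^l≤s^k ⟩
      (s ℕ.^ k) ℕ.^ suc j           ≡⟨ ℕ.^-*-assoc s k (suc j) ⟩
      s ℕ.^ (k ℕ.* suc j)           ∎))) ≤r)
    where open ℕ.≤-Reasoning

  loc : ∀ {q r} → q < r → Below q ⊎ Above r
  loc {mkℚ -[1+ _ ] _ _} q<r = inj₁ (0 , 0 , ≤-trans (toℚᵘ-cancel-≤ (ℚᵘ.*≤* -≤+)) (0≤ι 0) , proj₂ (proj₂ (proj₂ 0≤log)))
  loc {q@(mkℚ (+ i) j _)} q<r with s ℕ.^ i ℕ.≤? p ℕ.^ suc j
  ... | yes le = inj₁ (i , j , ≤-reflexive (frac-num-denom q refl) , le)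
  ... | no  gt = inj₂ (i , j , ≤-trans (≤-reflexive (sym (frac-num-denom q refl))) (<⇒≤ q<r) , ℕ.<⇒≤ (ℕ.≰⇒> gt))

0<log : (s p : ℕ) (2≤s : 2 ℕ.≤ s) (1≤p : 1 ℕ.≤ p) → s ℕ.≤ p → Lower (log s p 2≤s 1≤p) 0ℚ
0<log s p 2≤s 1≤p s≤p = 1ℚ , positive⁻¹ 1ℚ , 1 , 0 , ≤-reflexive (sym ι-one) , ℕ.*-monoˡ-≤ 1 s≤p

grid : ∀ α → Lower α 0ℚ → ∀ j → ∃[ i ] Lower α (frac i j) × Upper α (frac (2 ℕ.+ i) j)
grid α 0<α j = search K 0 (ℕ.+-identityʳ K) (subst (Lower α) (sym (frac-zero j)) 0<α)
  where
  u = proj₁ (upper-inhabited α)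
  n = proj₁ (archimedean u)
  K = n ℕ.* suc j

  u≤K/j : u ≤ frac K j
  u≤K/j = ≤-trans (proj₂ (archimedean u))
    (frac-mono-≤ (ℕ.≤-reflexive (sym (ℕ.*-identityʳ K))))

  step : ∀ i → frac i j < frac (suc i) j
  step i = frac-mono-< (ℕ.*-monoˡ-< (suc j) (ℕ.n<1+n i))

  search : ∀ fuel i → fuel ℕ.+ i ≡ K → Lower α (frac i j) →
           ∃[ i ] Lower α (frac i j) × Upper α (frac (2 ℕ.+ i) j)
  search zero i refl l =
    contradiction (<-≤-trans (lower<upper α l (proj₂ (upper-inhabited α))) u≤K/j) (<-irrefl refl)
  search (suc fuel) i eq l with located α (step (suc i))
  ... | inj₁ l′ = search fuel (suc i) (trans (ℕ.+-suc fuel i) eq) l′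
  ... | inj₂ u′ = i , l , u′

-- x^α for x ≥ 1 and α > 0: it is bounded below by x^(i/j) for i/j < α and
-- above by x^(i/j) for i/j > α.
pow : (x : ℚ) → 1ℚ ≤ x → (α : ℝ) → Lower α 0ℚ → ℝ
pow x 1≤x α 0<α = cut Below Above
  (1ℚ , 0 , 0 , 0<α′ , ≤-refl)
  (let i , _ , u = grid α 0<α 0 in
   x ^ (2 ℕ.+ i) , ^-pos (2 ℕ.+ i) 0<x , 2 ℕ.+ i , 0 , u , ≤-reflexive (sym (*-identityʳ _)))
  consistent loc
  where
  Below Above : ℚ → Set
  Below q = ∃₂ λ i j → Lower α (frac i j) × q ^ suc j ≤ x ^ i
  Above q = 0ℚ < q × ∃₂ λ i j → Upper α (frac i j) × x ^ i ≤ q ^ suc j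

  0<α′ = subst (Lower α) (sym (frac-zero 0)) 0<α
  0<x = <-≤-trans (positive⁻¹ 1ℚ) 1≤x
  0≤x = <⇒≤ 0<x

  consistent : ∀ {q r} → Below q → Above r → q ≤ r
  consistent {q} {r} (i , j , l , q^j≤x^i) (0<r , k , m , u , x^k≤r^m) with q ≤? r
  ... | yes q≤r = q≤r
  ... | no  q≰r = contradiction (begin-strict
    r ^ (suc m ℕ.* suc j)     <⟨ ^-mono-< (j ℕ.+ m ℕ.* suc j) (<⇒≤ 0<r) r<q ⟩
    q ^ (suc m ℕ.* suc j)     ≡⟨ cong (q ^_) (ℕ.*-comm (suc m) (suc j)) ⟩
    q ^ (suc j ℕ.* suc m)     ≡⟨ ^-assocʳ q (suc j) (suc m) ⟨
    (q ^ suc j) ^ suc m       ≤⟨ ^-mono-≤ (suc m) (^-nonNeg (suc j) (<⇒≤ (<-trans 0<r r<q))) q^j≤x^i ⟩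
    (x ^ i) ^ suc m         ≡⟨ ^-assocʳ (x) i (suc m) ⟩
    x ^ (i ℕ.* suc m)       ≤⟨ ^-mono-exponent 1≤x (ℕ.<⇒≤ (frac-cancel-< (lower<upper α l u))) ⟩
    x ^ (k ℕ.* suc j)       ≡⟨ ^-assocʳ (x) k (suc j) ⟨
    (x ^ k) ^ suc j         ≤⟨ ^-mono-≤ (suc j) (^-nonNeg k 0≤x) x^k≤r^m ⟩
    (r ^ suc m) ^ suc j       ≡⟨ ^-assocʳ r (suc m) (suc j) ⟩
    r ^ (suc m ℕ.* suc j)     ∎) (<-irrefl refl)
    where
    open ≤-Reasoning
    r<q = ≰⇒> q≰r

  loc : ∀ {q r} → q < r → Below q ⊎ Above r
  loc {q} {r} q<r with q ≤? 1ℚ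
  ... | yes q≤1 = inj₁ (0 , 0 , 0<α′ , ≤-trans (≤-reflexive (*-identityʳ q)) q≤1)
  ... | no  q≰1 = choose (grid α 0<α j)
    where
    open ≤-Reasoning
    0<q = <-trans (positive⁻¹ 1ℚ) (≰⇒> q≰1)
    j   = proj₁ (power-gap 0<q q<r (x ^ 2))
    gap = proj₂ (power-gap 0<q q<r (x ^ 2))
    choose : ∃[ i ] Lower α (frac i j) × Upper α (frac (2 ℕ.+ i) j) → Below q ⊎ Above r
    choose (i , l , u) with q ^ suc j ≤? x ^ i
    ... | yes le = inj₁ (i , j , l , le)
    ... | no  gt = inj₂ (<-trans 0<q q<r , 2 ℕ.+ i , j , u , (begin
      x ^ (2 ℕ.+ i)          ≡⟨ ^-homo-* (x) 2 i ⟩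
      x ^ 2 * x ^ i        ≡⟨ *-comm (x ^ 2) (x ^ i) ⟩
      x ^ i * x ^ 2        ≤⟨ *-monoʳ-≤-nonNeg (x ^ 2) {{nonNegative (^-nonNeg 2 0≤x)}} (<⇒≤ (≰⇒> gt)) ⟩
      q ^ suc j * x ^ 2      ≤⟨ gap ⟩
      r ^ suc j                ∎))

0<pow : ∀ x 1≤x α 0<α → Lower (pow x 1≤x α 0<α) 0ℚ
0<pow x 1≤x α 0<α = 1ℚ , positive⁻¹ 1ℚ , 0 , 0 , subst (Lower α) (sym (frac-zero 0)) 0<α , ≤-refl

-- a/y for y > 0: q is a lower bound when q u ≤ a for some u > y, and an upper
-- bound when a ≤ q l for some 0 < l < y.
quotient : (a : ℕ) (y : ℝ) → Lower y 0ℚ → ℝ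
quotient a y 0<y = cut Below Above
  (0ℚ , u₀ , upper-u₀ , ≤-trans (≤-reflexive (*-zeroˡ u₀)) 0≤a)
  (ι a * recip l₀ 0<l₀ , l₀ , lower-l₀ , 0<l₀ , ≤-reflexive (sym (recip-cancel (ι a) l₀ 0<l₀)))
  consistent loc
  where
  Below Above : ℚ → Set
  Below q = ∃[ u ] Upper y u × q * u ≤ ι a
  Above q = ∃[ l ] Lower y l × 0ℚ < l × ι a ≤ q * l

  0≤a : 0ℚ ≤ ι a
  0≤a = 0≤ι a

  u₀ = proj₁ (upper-inhabited y)
  upper-u₀ = proj₂ (upper-inhabited y)
  0<u₀ = lower<upper y 0<y upper-u₀
  l₀ = proj₁ (lower-open y 0<y)
  0<l₀ = proj₁ (proj₂ (lower-open y 0<y))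
  lower-l₀ = proj₂ (proj₂ (lower-open y 0<y))

  consistent : ∀ {q r} → Below q → Above r → q ≤ r
  consistent {q} {r} (u , upper-u , qu≤a) (l , lower-l , 0<l , a≤rl) with q ≤? r
  ... | yes q≤r = q≤r
  ... | no  q≰r = contradiction (begin-strict
    r * l   ≤⟨ *-monoˡ-≤-nonNeg r {{nonNegative 0≤r}} (<⇒≤ l<u) ⟩
    r * u   <⟨ *-monoˡ-<-pos u {{positive (<-trans 0<l l<u)}} (≰⇒> q≰r) ⟩
    q * u   ≤⟨ qu≤a ⟩
    ι a     ≤⟨ a≤rl ⟩
    r * l   ∎) (<-irrefl refl)
    where
    open ≤-Reasoning
    l<u = lower<upper y lower-l upper-u
    0≤r : 0ℚ ≤ r
    0≤r = *-cancelʳ-≤-pos l {{positive 0<l}} (≤-trans (≤-reflexive (*-zeroˡ l)) (≤-trans 0≤a a≤rl))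

  loc : ∀ {q r} → q < r → Below q ⊎ Above r
  loc {q} {r} q<r with q ≤? 0ℚ
  ... | yes q≤0 = inj₁ (u₀ , upper-u₀ ,
    ≤-trans (*-monoʳ-≤-nonNeg u₀ {{nonNegative (<⇒≤ 0<u₀)}} q≤0) (≤-trans (≤-reflexive (*-zeroˡ u₀)) 0≤a))
  ... | no  q≰0 = choose (0ℚ <? ι a)
    where
    open ≤-Reasoning
    0<q = ≰⇒> q≰0
    0<r = <-trans 0<q q<r
    a/q = ι a * recip q 0<q
    a/r = ι a * recip r 0<r

    positive-quotient : ∀ d (0<d : 0ℚ < d) → 0ℚ < ι a → 0ℚ < ι a * recip d 0<d
    positive-quotient d 0<d 0<a = subst (_< ι a * recip d 0<d) (*-zeroʳ (ι a))
      (*-monoʳ-<-pos (ι a) {{positive 0<a}} (0<recip d 0<d))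

    a/r<a/q : 0ℚ < ι a → a/r < a/q
    a/r<a/q 0<a = *-cancelʳ-<-nonNeg r {{nonNegative (<⇒≤ 0<r)}} (begin-strict
      a/r * r   ≡⟨ recip-cancel (ι a) r 0<r ⟩
      ι a       ≡⟨ recip-cancel (ι a) q 0<q ⟨
      a/q * q   <⟨ *-monoʳ-<-pos a/q {{positive (positive-quotient q 0<q 0<a)}} q<r ⟩
      a/q * r   ∎)

    choose : Dec (0ℚ < ι a) → Below q ⊎ Above r
    choose (no 0≮a) = inj₂ (l₀ , lower-l₀ , 0<l₀ ,
      ≤-trans (≮⇒≥ 0≮a) (*-mono-≤-nonNeg {0ℚ} {r} {0ℚ} {l₀} ≤-refl ≤-refl (<⇒≤ 0<r) (<⇒≤ 0<l₀)))
    choose (yes 0<a) with located y (a/r<a/q 0<a)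
    ... | inj₁ l = inj₂ (a/r , l , positive-quotient r 0<r 0<a ,
            ≤-reflexive (sym (trans (*-comm r a/r) (recip-cancel (ι a) r 0<r))))
    ... | inj₂ u = inj₁ (a/q , u , ≤-reflexive (trans (*-comm q a/q) (recip-cancel (ι a) q 0<q)))

-- digit i is the coefficient of s^i.  leading≢0 matters: when h 0 ≠ 0, padding
-- with zero digits changes the sum defining a.
record Expansion (s n : ℕ) : Set where
  field
    top       : ℕ
    digit     : Fin (suc top) → Fin s
    leading≢0 : toℕ (digit (fromℕ top)) ≢ 0
    value     : n ≡ ∑[ i < suc top ] (toℕ (digit i) ℕ.* s ℕ.^ toℕ i)

expand : ∀ s → 2 ℕ.≤ s → ∀ n .{{_ : NonZero n}} → Expansion s n
expand s@(suc (suc _)) (s≤s (s≤s z≤n)) n = go n (<-wellFounded n)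
  where
  open ≡-Reasoning

  go : ∀ n .{{_ : NonZero n}} → Acc ℕ._<_ n → Expansion s n
  go n (acc rec) with n ℕ.<? s
  ... | yes n<s = record
    { top       = 0
    ; digit     = λ _ → fromℕ< n<s
    ; leading≢0 = λ n≡0 → ℕ.≢-nonZero⁻¹ n (trans (sym (Fin.toℕ-fromℕ< n<s)) n≡0)
    ; value     = sym (trans (ℕ.+-identityʳ _) (trans (ℕ.*-identityʳ _) (Fin.toℕ-fromℕ< n<s)))
    }
  ... | no  n≮s = record
    { top       = suc (Expansion.top e)
    ; digit     = λ { zero → fromℕ< (m%n<n n s) ; (suc i) → Expansion.digit e i }
    ; leading≢0 = Expansion.leading≢0 e
    ; value     = begin
        n                                   ≡⟨ m≡m%n+[m/n]*n n s ⟩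
        n % s ℕ.+ n / s ℕ.* s               ≡⟨ cong₂ ℕ._+_ low high ⟩
        _                                   ∎
    }
    where
    instance n/s-nonZero = ℕ.>-nonZero (m≥n⇒m/n>0 {n} {s} (ℕ.≮⇒≥ n≮s))
    e = go (n / s) (rec (m/n<m n s (s≤s (s≤s z≤n))))
    low : n % s ≡ toℕ (fromℕ< (m%n<n n s)) ℕ.* 1
    low = sym (trans (ℕ.*-identityʳ _) (Fin.toℕ-fromℕ< (m%n<n n s)))
    high : n / s ℕ.* s ≡ ∑[ i < suc (Expansion.top e) ] (toℕ (Expansion.digit e i) ℕ.* (s ℕ.* s ℕ.^ toℕ i))
    high = begin
      n / s ℕ.* s   ≡⟨ cong (ℕ._* s) (Expansion.value e) ⟩
      (∑[ i < suc (Expansion.top e) ] (toℕ (Expansion.digit e i) ℕ.* s ℕ.^ toℕ i)) ℕ.* s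
        ≡⟨ *-distribʳ-sum {suc (Expansion.top e)} s (λ i → toℕ (Expansion.digit e i) ℕ.* s ℕ.^ toℕ i) ⟩
      ∑[ i < suc (Expansion.top e) ] (toℕ (Expansion.digit e i) ℕ.* s ℕ.^ toℕ i ℕ.* s)
        ≡⟨ sum-cong-≋ (λ i → trans (ℕ.*-assoc (toℕ (Expansion.digit e i)) (s ℕ.^ toℕ i) s)
             (cong (toℕ (Expansion.digit e i) ℕ.*_) (ℕ.*-comm (s ℕ.^ toℕ i) s))) ⟩
      _ ∎

module _ {p s : ℕ} {A : Subset p} (h : Fin s ⤖ ∃ (_∈ A)) where

  digitMap : Fin s → ℕ
  digitMap d = toℕ (proj₁ (Bijection.to h d))

  StrictlyIncreasing : Set
  StrictlyIncreasing = digitMap Preserves Fin._<_ ⟶ ℕ._<_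

  a : 2 ℕ.≤ s → (n : ℕ) .{{_ : NonZero n}} → ℕ
  a 2≤s n = ∑[ i < suc top ] (digitMap (digit i) ℕ.* p ℕ.^ toℕ i)
    where open Expansion (expand s 2≤s n)

  b : 2 ℕ.≤ s → s ℕ.< p → (n : ℕ) .{{_ : NonZero n}} → ℝ
  b 2≤s s<p n = quotient (a 2≤s n) (pow (ι n) (1≤ι n) α 0<α) (0<pow (ι n) (1≤ι n) α 0<α)
    where
    1≤p = ℕ.≤-trans (s≤s z≤n) s<p
    α   = log s p 2≤s 1≤p
    0<α = 0<log s p 2≤s 1≤p (ℕ.<⇒≤ s<p)

Sequence : Set₁
Sequence = (n : ℕ) .{{_ : NonZero n}} → ℝ

IsInfimum : Sequence → ℝ → Set₁
IsInfimum c m = (∀ n .{{_ : NonZero n}} → m ≤ᴿ c n) ×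
                (∀ y → (∀ n .{{_ : NonZero n}} → y ≤ᴿ c n) → y ≤ᴿ m)

IsSupremum : Sequence → ℝ → Set₁
IsSupremum c M = (∀ n .{{_ : NonZero n}} → c n ≤ᴿ M) ×
                 (∀ y → (∀ n .{{_ : NonZero n}} → c n ≤ᴿ y) → M ≤ᴿ y)

infix 4 _∈[_,_] _ConvergesTo_

_∈[_,_] : ℝ → ℝ → ℝ → Set
x ∈[ m , M ] = m ≤ᴿ x × x ≤ᴿ M

_ConvergesTo_ : (ℕ → ℝ) → ℝ → Set
c ConvergesTo x = ∀ ε → 0ℚ < ε → ∃[ K ] (∀ k → K ℕ.≤ k → ∣ c k - x ∣< ε)

AccumulationPoint : Sequence → ℝ → Set
AccumulationPoint c x =
  Σ[ ν ∈ (ℕ → ℕ) ] (ν Preserves ℕ._<_ ⟶ ℕ._<_) ×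
  Σ[ ν>0 ∈ (∀ k → NonZero (ν k)) ] (λ k → c (ν k) {{ν>0 k}}) ConvergesTo x

DenseIn : Sequence → ℝ → ℝ → Set₁
DenseIn c m M = (∀ n .{{_ : NonZero n}} → c n ∈[ m , M ]) ×
                (∀ x → x ∈[ m , M ] → ∀ ε → 0ℚ < ε → ∃[ n ] Σ[ n>0 ∈ NonZero n ] ∣ c n {{n>0}} - x ∣< ε)

{-# OPTIONS --safe #-}

-- Put a₀ = 0.  Appending a digit multiplies a by p and adds less than p, so a is
-- strictly increasing, p^j a_n ≤ a_{s^j n} and a_{s^j n - 1} < p^j a_n.  Since
-- (s^j n)^α = p^j n^α for α = log_s p, every b_n is therefore approximated
-- arbitrarily far out from above by b_{s^j n} ≥ b_n, and from below by
-- b_{s^j n - 1}, which exceeds b_n at most by a factor tending to 1.  Monotonicity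
-- of a also gives b_{n+1} ≥ b_n (n/(n+1))^α, so b decreases by vanishing steps
-- only.  Walking from a far term above a given point of [m , M] to a further term
-- below it, b must pass close to that point.  Comparing b_n with the term indexed
-- by the leading digits of n makes m and M located.
module Submission where

open import Defs

-- In general neither b_{s^j n} nor b_{s^j n - 1} tends to b_n: each appended digit 0 contributes
-- h(0), and a may jump at multiples of s^j. One-sided estimates suffice, because the walk needs
-- only a far term above the target and a farther one below it. The same upward jumps, which need
-- not be small against n^α, force the walk to run downwards. The other constraint is constructive.
-- The order of reals is not decidable, and a bounded sequence does not automatically have an
-- infimum given by a located cut. Decisions are therefore taken between rationals, through
-- `located`, or between integer powers, where i/j below or above α means s^i ≤ p^j or p^j ≤ s^i.
-- Estimates for b come as factors, which the boundedness of b turns into additive errors.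
-- `SlowlyRecurrent` collects what the final argument uses.

module DigitSums where

  open import Data.Nat.Base using (ℕ; zero; suc; _+_; _∸_; _*_; _^_; _≤_; _<_; z≤n; s≤s; NonZero; s≤s⁻¹; >-nonZero; >-nonZero⁻¹)
  open import Data.Nat.Properties
  open import Data.Nat.DivMod using (_/_; _%_; m≡m%n+[m/n]*n; m%n<n; m/n<m; m/n*n≤m; m<n*o⇒m/o<n; m<n⇒m%n≡m; [m+kn]%n≡m%n)
  open import Data.Nat.Induction using (<-rec)
  open import Algebra.Properties.CommutativeMonoid.Sum +-0-commutativeMonoid using (sum-syntax; sum-cong-≋)
  open import Algebra.Properties.Semiring.Sum +-*-semiring using (*-distribʳ-sum)
  open import Data.Fin.Base as Fin using (Fin; zero; suc; toℕ; fromℕ; fromℕ<)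
  import Data.Fin.Properties as Fin
  open import Data.Fin.Subset using (Subset; _∈_)
  open import Data.Product.Base using (∃; ∃₂; _×_; _,_; proj₁)
  open import Function.Base using (_∘_)
  open import Function.Bundles using (_⤖_; Bijection)
  open import Relation.Binary.PropositionalEquality using (_≡_; _≢_; sym; trans; cong; cong₂; subst; module ≡-Reasoning)
  open import Relation.Nullary using (yes; no; contradiction)


  -- Uniqueness of base-s expansions; prefixes of a number.

  horner : ∀ {k} b (f : Fin (suc k) → ℕ) →
           ∑[ i < suc k ] (f i * b ^ toℕ i) ≡ f zero + (∑[ i < k ] (f (suc i) * b ^ toℕ i)) * b
  horner {k} b f = cong₂ _+_ (*-identityʳ (f zero)) (begin
    ∑[ i < k ] (f (suc i) * (b * b ^ toℕ i))     ≡⟨ sum-cong-≋ (λ i → trans (cong (f (suc i) *_) (*-comm b (b ^ toℕ i)))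
                                                      (sym (*-assoc (f (suc i)) (b ^ toℕ i) b))) ⟩
    ∑[ i < k ] (f (suc i) * b ^ toℕ i * b)       ≡⟨ *-distribʳ-sum {k} b (λ i → f (suc i) * b ^ toℕ i) ⟨
    (∑[ i < k ] (f (suc i) * b ^ toℕ i)) * b     ∎)
    where open ≡-Reasoning

  digit+quotient-injective : ∀ {s} (d e : Fin s) {x y} → toℕ d + x * s ≡ toℕ e + y * s → d ≡ e × x ≡ y
  digit+quotient-injective {s@(suc _)} d e {x} {y} eq = Fin.toℕ-injective d≡e ,
    *-cancelʳ-≡ x y s (+-cancelˡ-≡ (toℕ d) (x * s) (y * s) (trans eq (cong (_+ y * s) (sym d≡e))))
    where
    digit : ∀ (d : Fin s) x → toℕ d ≡ (toℕ d + x * s) % s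
    digit d x = sym (trans ([m+kn]%n≡m%n (toℕ d) x s) (m<n⇒m%n≡m (Fin.toℕ<n d)))
    d≡e : toℕ d ≡ toℕ e
    d≡e = trans (digit d x) (trans (cong (_% s) eq) (sym (digit e y)))

  leading≢0⇒sum≢0 : ∀ {s} k (d : Fin (suc k) → Fin s) → toℕ (d (fromℕ k)) ≢ 0 →
                    ∑[ i < suc k ] (toℕ (d i) * s ^ toℕ i) ≢ 0
  leading≢0⇒sum≢0 zero d lead eq =
    lead (trans (sym (trans (+-identityʳ _) (*-identityʳ _))) eq)
  leading≢0⇒sum≢0 {zero} (suc k) d lead eq = contradiction (d zero) λ ()
  leading≢0⇒sum≢0 {s@(suc _)} (suc k) d lead eq = leading≢0⇒sum≢0 k (d ∘ suc) lead
    (m*n≡0⇒m≡0 _ s (m+n≡0⇒n≡0 (toℕ (d zero)) (trans (sym (horner s (toℕ ∘ d))) eq)))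

  -- Reducing modulo s matches the lowest digits and leaves equal quotients. If one expansion ends
  -- first, the quotient of the other is 0, which its leading digit forbids. The conclusion concerns
  -- sums and not digits because the digit functions have different domains until the lengths are
  -- known to agree.
  digits-unique : ∀ {s} j k (d : Fin (suc j) → Fin s) (e : Fin (suc k) → Fin s) →
                  toℕ (d (fromℕ j)) ≢ 0 → toℕ (e (fromℕ k)) ≢ 0 →
                  ∑[ i < suc j ] (toℕ (d i) * s ^ toℕ i) ≡ ∑[ i < suc k ] (toℕ (e i) * s ^ toℕ i) →
                  ∀ (g : Fin s → ℕ) p →
                  ∑[ i < suc j ] (g (d i) * p ^ toℕ i) ≡ ∑[ i < suc k ] (g (e i) * p ^ toℕ i)
  digits-unique {s} j k d e d≢0 e≢0 eq g p
    with digit+quotient-injective (d zero) (e zero)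
           {∑[ i < j ] (toℕ (d (suc i)) * s ^ toℕ i)} {∑[ i < k ] (toℕ (e (suc i)) * s ^ toℕ i)}
           (trans (sym (horner s (toℕ ∘ d))) (trans eq (horner s (toℕ ∘ e))))
  digits-unique zero zero d e d≢0 e≢0 eq g p | d₀≡e₀ , _ = cong (λ i → g i * 1 + 0) d₀≡e₀
  digits-unique zero (suc k) d e d≢0 e≢0 eq g p | _ , rest = contradiction (sym rest) (leading≢0⇒sum≢0 k (e ∘ suc) e≢0)
  digits-unique (suc j) zero d e d≢0 e≢0 eq g p | _ , rest = contradiction rest (leading≢0⇒sum≢0 j (d ∘ suc) d≢0)
  digits-unique (suc j) (suc k) d e d≢0 e≢0 eq g p | d₀≡e₀ , rest = begin
    ∑[ i < suc (suc j) ] (g (d i) * p ^ toℕ i)                       ≡⟨ horner p (g ∘ d) ⟩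
    g (d zero) + (∑[ i < suc j ] (g (d (suc i)) * p ^ toℕ i)) * p
      ≡⟨ cong₂ (λ i t → g i + t * p) d₀≡e₀ (digits-unique j k (d ∘ suc) (e ∘ suc) d≢0 e≢0 rest g p) ⟩
    g (e zero) + (∑[ i < suc k ] (g (e (suc i)) * p ^ toℕ i)) * p    ≡⟨ horner p (g ∘ e) ⟨
    ∑[ i < suc (suc k) ] (g (e i) * p ^ toℕ i)                       ∎
    where open ≡-Reasoning

  -- The block of s^j consecutive integers whose expansions start with that of m.
  _∈block_,_of_ : ℕ → ℕ → ℕ → ℕ → Set
  n ∈block j , m of s = s ^ j * m ≤ n × n < s ^ j * suc m

  -- Division by s drops the last digit; stop once the number is below N s. Since N ≤ m < N s,
  -- finitely many prefixes serve all n ≥ N.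
  block-prefix : ∀ s → 2 ≤ s → ∀ N .{{_ : NonZero N}} n → N ≤ n →
                 ∃₂ λ j m → N ≤ m × m < N * s × n ∈block j , m of s
  block-prefix s@(suc (suc _)) (s≤s (s≤s z≤n)) N = <-rec _ go
    where
    go : ∀ n → (∀ {k} → k < n → N ≤ k → ∃₂ λ j m → N ≤ m × m < N * s × k ∈block j , m of s) →
         N ≤ n → ∃₂ λ j m → N ≤ m × m < N * s × n ∈block j , m of s
    go n rec N≤n with n <? N * s
    ... | yes n<N*s = 0 , n , N≤n , n<N*s , ≤-reflexive (*-identityˡ n) , ≤-reflexive (sym (*-identityˡ (suc n)))
    ... | no  n≮N*s =
      let instance n-nonZero = >-nonZero (<-≤-trans (>-nonZero⁻¹ N) N≤n)
          j , m , N≤m , m<N*s , below , above = rec (m/n<m n s (s≤s (s≤s z≤n))) N≤n/s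
      in suc j , m , N≤m , m<N*s , (begin
           s * s ^ j * m         ≡⟨ trans (*-assoc s (s ^ j) m) (*-comm s (s ^ j * m)) ⟩
           s ^ j * m * s         ≤⟨ *-monoˡ-≤ s below ⟩
           n / s * s             ≤⟨ m/n*n≤m n s ⟩
           n                     ∎) , (begin-strict
           n                     ≡⟨ m≡m%n+[m/n]*n n s ⟩
           n % s + n / s * s     <⟨ +-monoˡ-< (n / s * s) (m%n<n n s) ⟩
           suc (n / s) * s       ≤⟨ *-monoˡ-≤ s above ⟩
           s ^ j * suc m * s     ≡⟨ trans (*-assoc s (s ^ j) (suc m)) (*-comm s (s ^ j * suc m)) ⟨
           s * s ^ j * suc m     ∎)
      where
      open ≤-Reasoning
      N≤n/s : N ≤ n / s
      N≤n/s = ≮⇒≥ λ n/s<N → n≮N*s (begin-strict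
        n                     ≡⟨ m≡m%n+[m/n]*n n s ⟩
        n % s + n / s * s     <⟨ +-monoˡ-< (n / s * s) (m%n<n n s) ⟩
        suc (n / s) * s       ≤⟨ *-monoˡ-≤ s n/s<N ⟩
        N * s                 ∎)

  -- Monotonicity and approximate self-similarity of a.

  module Digits {p s : ℕ} (2≤s : 2 ≤ s) {A : Subset p} (h : Fin s ⤖ ∃ (_∈ A)) (h-increasing : StrictlyIncreasing h) where

    instance
      s-nonZero : NonZero s
      s-nonZero = >-nonZero (<-trans (s≤s z≤n) 2≤s)

    digitMap<p : ∀ d → digitMap h d < p
    digitMap<p d = Fin.toℕ<n (proj₁ (Bijection.to h d))

    -- The value 0 is that of the empty expansion; a single digit 0 would give h(0). It makes the
    -- rule for appending a digit cover one-digit numbers too.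
    a₀ : ℕ → ℕ
    a₀ zero    = 0
    a₀ (suc n) = a h 2≤s (suc n)

    -- Frees a from the particular expansion found by `expand`, so that expansions may be built by
    -- appending digits.
    a₀-expansion : ∀ {n} (E : Expansion s n) →
                   a₀ n ≡ ∑[ i < suc (Expansion.top E) ] (digitMap h (Expansion.digit E i) * p ^ toℕ i)
    a₀-expansion {zero}  E = contradiction (sym (Expansion.value E))
      (leading≢0⇒sum≢0 (Expansion.top E) (Expansion.digit E) (Expansion.leading≢0 E))
    a₀-expansion {suc n} E = digits-unique E′.top E.top E′.digit E.digit E′.leading≢0 E.leading≢0
      (trans (sym E′.value) E.value) (digitMap h) p
      where
      module E′ = Expansion (expand s 2≤s (suc n))
      module E = Expansion E

    -- The excluded case appends the digit 0 to 0: there the left side is 0 and the right side h(0).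
    a₀-digit : ∀ (d : Fin s) m → toℕ d + m * s ≢ 0 → a₀ (toℕ d + m * s) ≡ digitMap h d + a₀ m * p
    a₀-digit d zero d≢0 = trans (a₀-expansion E) (cong (_+ 0) (*-identityʳ (digitMap h d)))
      where
      E : Expansion s (toℕ d + 0)
      E = record
        { top       = 0
        ; digit     = λ _ → d
        ; leading≢0 = λ d≡0 → d≢0 (trans (+-identityʳ (toℕ d)) d≡0)
        ; value     = cong (_+ 0) (sym (*-identityʳ (toℕ d)))
        }
    a₀-digit d m@(suc _) _ = trans (a₀-expansion E)
      (trans (horner p (digitMap h ∘ Expansion.digit E)) (cong (λ t → digitMap h d + t * p) (sym (a₀-expansion E′))))
      where
      E′ = expand s 2≤s m
      digits : Fin (2 + Expansion.top E′) → Fin s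
      digits zero    = d
      digits (suc i) = Expansion.digit E′ i
      E : Expansion s (toℕ d + m * s)
      E = record
        { top       = suc (Expansion.top E′)
        ; digit     = digits
        ; leading≢0 = Expansion.leading≢0 E′
        ; value     = trans (cong (λ t → toℕ d + t * s) (Expansion.value E′)) (sym (horner s (toℕ ∘ digits)))
        }

    a₀-digit-≤ : ∀ (d : Fin s) m → a₀ (toℕ d + m * s) ≤ digitMap h d + a₀ m * p
    a₀-digit-≤ d m with toℕ d + m * s in eq
    ... | zero  = z≤n
    ... | suc _ = ≤-reflexive (trans (cong a₀ (sym eq)) (a₀-digit d m λ eq′ → contradiction (trans (sym eq) eq′) λ ()))

    a₀-*s : ∀ m → a₀ m * p ≤ a₀ (m * s)
    a₀-*s zero    = z≤n
    a₀-*s m@(suc _) = begin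
      a₀ m * p                          ≤⟨ m≤n+m (a₀ m * p) (digitMap h zero′) ⟩
      digitMap h zero′ + a₀ m * p       ≡⟨ a₀-digit zero′ m (1+n≢0 ∘ m*n≡0⇒m≡0 m s ∘ m+n≡0⇒n≡0 (toℕ zero′)) ⟨
      a₀ (toℕ zero′ + m * s)            ≡⟨ cong (λ d → a₀ (d + m * s)) zero′≡0 ⟩
      a₀ (m * s)                        ∎
      where
      open ≤-Reasoning
      zero′ = fromℕ< (>-nonZero⁻¹ s)
      zero′≡0 = Fin.toℕ-fromℕ< (>-nonZero⁻¹ s)

    last-digit : ℕ → Fin s
    last-digit n = fromℕ< (m%n<n n s)

    split : ∀ n → n ≡ toℕ (last-digit n) + n / s * s
    split n = trans (m≡m%n+[m/n]*n n s) (cong (_+ n / s * s) (sym (Fin.toℕ-fromℕ< (m%n<n n s))))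

    a₀-</s : ∀ n → a₀ n < suc (a₀ (n / s)) * p
    a₀-</s n = begin-strict
      a₀ n                                         ≡⟨ cong a₀ (split n) ⟩
      a₀ (toℕ (last-digit n) + n / s * s)          ≤⟨ a₀-digit-≤ (last-digit n) (n / s) ⟩
      digitMap h (last-digit n) + a₀ (n / s) * p   <⟨ +-monoˡ-< (a₀ (n / s) * p) (digitMap<p (last-digit n)) ⟩
      suc (a₀ (n / s)) * p                         ∎
      where open ≤-Reasoning

    -- Without a carry only the last digit grows, and h is increasing. With a carry, n + 1 = (n/s +
    -- 1) s, and the gain of at least 1 at n/s, multiplied by p, outweighs the lost digit, which is
    -- below p.
    a₀-step : ∀ n → a₀ n < a₀ (suc n)
    a₀-step = <-rec _ go
      where
      open ≤-Reasoning
      go : ∀ n → (∀ {m} → m < n → a₀ m < a₀ (suc m)) → a₀ n < a₀ (suc n)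
      go n rec with suc (toℕ (last-digit n)) <? s
      ... | yes 1+d<s = begin-strict
        a₀ n                                         ≡⟨ cong a₀ (split n) ⟩
        a₀ (toℕ d + n / s * s)                       ≤⟨ a₀-digit-≤ d (n / s) ⟩
        digitMap h d + a₀ (n / s) * p                <⟨ +-monoˡ-< (a₀ (n / s) * p) (h-increasing (≤-reflexive (sym d′≡1+d))) ⟩
        digitMap h d′ + a₀ (n / s) * p               ≡⟨ a₀-digit d′ (n / s) (1+n≢0 ∘ trans 1+n) ⟨
        a₀ (toℕ d′ + n / s * s)                      ≡⟨ cong a₀ 1+n ⟨
        a₀ (suc n)                                   ∎
        where
        d = last-digit n
        d′ = fromℕ< 1+d<s
        d′≡1+d = Fin.toℕ-fromℕ< 1+d<s
        1+n : suc n ≡ toℕ d′ + n / s * s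
        1+n = trans (cong suc (split n)) (cong (_+ n / s * s) (sym d′≡1+d))
      ... | no  1+d≮s = begin-strict
        a₀ n                       <⟨ a₀-</s n ⟩
        suc (a₀ (n / s)) * p       ≤⟨ *-monoˡ-≤ p (rec (m/n<m n s {{>-nonZero 0<n}} 2≤s)) ⟩
        a₀ (suc (n / s)) * p       ≤⟨ a₀-*s (suc (n / s)) ⟩
        a₀ (suc (n / s) * s)       ≡⟨ cong a₀ 1+n ⟨
        a₀ (suc n)                 ∎
        where
        1+d≡s : suc (toℕ (last-digit n)) ≡ s
        1+d≡s = ≤-antisym (Fin.toℕ<n (last-digit n)) (≮⇒≥ 1+d≮s)
        1+n : suc n ≡ suc (n / s) * s
        1+n = trans (cong suc (split n)) (cong (_+ n / s * s) 1+d≡s)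
        -- The recursive call needs n/s < n, hence n > 0; in the carry case the last digit is s - 1
        -- ≥ 1.
        0<n : 0 < n
        0<n = s≤s⁻¹ (begin
          2                               ≤⟨ 2≤s ⟩
          s                               ≡⟨ 1+d≡s ⟨
          suc (toℕ (last-digit n))        ≤⟨ s≤s (m≤m+n (toℕ (last-digit n)) (n / s * s)) ⟩
          suc (toℕ (last-digit n) + n / s * s)  ≡⟨ cong suc (split n) ⟨
          suc n                           ∎)

    a₀-mono : ∀ {m n} → m ≤ n → a₀ m ≤ a₀ n
    a₀-mono {m} {n} m≤n = subst (λ k → a₀ m ≤ a₀ k) (m∸n+n≡m m≤n) (climb (n ∸ m))
      where
      climb : ∀ d → a₀ m ≤ a₀ (d + m)
      climb zero    = ≤-refl
      climb (suc d) = ≤-trans (climb d) (<⇒≤ (a₀-step (d + m)))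

    n≤a₀ : ∀ n → n ≤ a₀ n
    n≤a₀ zero    = z≤n
    n≤a₀ (suc n) = ≤-<-trans (n≤a₀ n) (a₀-step n)

    a₀-block-≥ : ∀ j m → p ^ j * a₀ m ≤ a₀ (s ^ j * m)
    a₀-block-≥ zero    m = ≤-reflexive (trans (*-identityˡ (a₀ m)) (cong a₀ (sym (*-identityˡ m))))
    a₀-block-≥ (suc j) m = begin
      p * p ^ j * a₀ m           ≡⟨ trans (*-assoc p (p ^ j) (a₀ m)) (*-comm p (p ^ j * a₀ m)) ⟩
      p ^ j * a₀ m * p           ≤⟨ *-monoˡ-≤ p (a₀-block-≥ j m) ⟩
      a₀ (s ^ j * m) * p         ≤⟨ a₀-*s (s ^ j * m) ⟩
      a₀ (s ^ j * m * s)         ≡⟨ cong a₀ (trans (*-assoc s (s ^ j) m) (*-comm s (s ^ j * m))) ⟨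
      a₀ (s * s ^ j * m)         ∎
      where open ≤-Reasoning

    a₀-block-< : ∀ j {m n} → n < s ^ j * suc m → a₀ n < p ^ j * suc (a₀ m)
    a₀-block-< zero {m} {n} lt = begin-strict
      a₀ n                       ≤⟨ a₀-mono (s≤s⁻¹ (≤-trans lt (≤-reflexive (*-identityˡ (suc m))))) ⟩
      a₀ m                       <⟨ n<1+n (a₀ m) ⟩
      suc (a₀ m)                 ≡⟨ *-identityˡ (suc (a₀ m)) ⟨
      1 * suc (a₀ m)             ∎
      where open ≤-Reasoning
    a₀-block-< (suc j) {m} {n} lt = begin-strict
      a₀ n                           <⟨ a₀-</s n ⟩
      suc (a₀ (n / s)) * p           ≤⟨ *-monoˡ-≤ p (a₀-block-< j (m<n*o⇒m/o<n (<-≤-trans lt (≤-reflexive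
                                          (trans (*-assoc s (s ^ j) (suc m)) (*-comm s (s ^ j * suc m))))))) ⟩
      p ^ j * suc (a₀ m) * p         ≡⟨ trans (*-assoc p (p ^ j) (suc (a₀ m))) (*-comm p (p ^ j * suc (a₀ m))) ⟨
      p * p ^ j * suc (a₀ m)         ∎
      where open ≤-Reasoning

module RealSequences where

  open import Data.Nat.Base as ℕ using (ℕ; zero; suc; z≤n; s≤s)
  import Data.Nat.Properties as ℕ
  import Data.Integer.Base as ℤ
  import Data.Integer.Properties as ℤ
  open import Data.Rational.Unnormalised.Base as ℚᵘ using (mkℚᵘ)
  import Data.Rational.Unnormalised.Properties as ℚᵘ
  open import Data.Rational.Base using (ℚ; 0ℚ; 1ℚ; ½; _+_; _-_; _*_; -_; _≤_; _<_; positive; nonNegative; toℚᵘ)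
  open import Data.Rational.Properties
  open import Data.Rational.Solver using (module +-*-Solver)
  open import Data.Fin.Base using (Fin)
  open import Data.Fin.Subset using (Subset; _∈_)
  open import Data.Product.Base using (Σ-syntax; ∃; ∃-syntax; _×_; _,_; proj₁; proj₂)
  open import Data.Sum.Base using (_⊎_; inj₁; inj₂; [_,_]′; swap)
  open import Function.Base using (_∘_; id)
  open import Function.Bundles using (_⤖_)
  open import Algebra.Bundles using (CommutativeRing)
  open import Algebra.Properties.CommutativeSemigroup ℕ.*-commutativeSemigroup using (interchange)
  open import Algebra.Properties.CommutativeSemiring.Exp (CommutativeRing.commutativeSemiring +-*-commutativeRing)
    using (_^_; ^-assocʳ; ^-distrib-*)
  open import Relation.Binary.Core using (_Preserves_⟶_)
  open import Relation.Binary.PropositionalEquality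
    using (_≡_; refl; sym; trans; cong; cong₂; subst; subst₂; module ≡-Reasoning)
  open import Relation.Nullary using (yes; no; contradiction)
  open +-*-Solver
  open DigitSums

  -- Rational bounds of cuts.

  p<p+q : ∀ p {q} → 0ℚ < q → p < p + q
  p<p+q p {q} 0<q = subst (_< p + q) (+-identityʳ p) (+-monoʳ-< p 0<q)

  p-q<p : ∀ p {q} → 0ℚ < q → p - q < p
  p-q<p p {q} 0<q = subst (p - q <_) (+-identityʳ p) (+-monoʳ-< p (neg-antimono-< 0<q))

  0<½* : ∀ {ε} → 0ℚ < ε → 0ℚ < ½ * ε
  0<½* {ε} 0<ε = subst (_< ½ * ε) (*-zeroʳ ½) (*-monoʳ-<-pos ½ 0<ε)

  ½+½ : ∀ ε → ½ * ε + ½ * ε ≡ ε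
  ½+½ ε = solve 1 (λ e → con ½ :* e :+ con ½ :* e := e) refl ε

  p+q-q : ∀ p q → p + q - q ≡ p
  p+q-q = solve 2 (λ p q → p :+ q :- q := p) refl

  lower-≤ : ∀ x {q r} → q ≤ r → Lower x r → Lower x q
  lower-≤ x q≤r l = let t , r<t , l′ = lower-open x l in lower-closed x (≤-<-trans q≤r r<t) l′

  -- Only the lower cuts are compared by _≤ᴿ_, so upper bounds transfer with a loss.
  upper-<-respʳ : ∀ {x y q r} → x ≤ᴿ y → q < r → Upper y q → Upper x r
  upper-<-respʳ {x} {y} x≤y q<r u with located x q<r
  ... | inj₁ l  = contradiction u (disjoint y (x≤y l))
  ... | inj₂ u′ = u′

  shift-upper : ∀ {x y} ε → x ≤ᴿ y ⊕ ε → ∀ {q r} → q + ε < r → Upper y q → Upper x r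
  shift-upper {x} {y} ε x≤y+ε {q} lt u =
    upper-<-respʳ {x} {y ⊕ ε} x≤y+ε lt (subst (Upper y) (sym (p+q-q q ε)) u)

  0<q-p : ∀ {p q} → p < q → 0ℚ < q - p
  0<q-p {p} {q} p<q = subst (_< q - p) (+-inverseʳ p) (+-monoˡ-< (- p) p<q)

  0<ι-suc : ∀ n → 0ℚ < ι (suc n)
  0<ι-suc n = <-≤-trans (positive⁻¹ 1ℚ) (1≤ι (suc n))

  *-cancelʳ-pos : ∀ {p q} r → 0ℚ < r → p * r ≡ q * r → p ≡ q
  *-cancelʳ-pos r 0<r eq = ≤-antisym (*-cancelʳ-≤-pos r {{positive 0<r}} (≤-reflexive eq))
                                     (*-cancelʳ-≤-pos r {{positive 0<r}} (≤-reflexive (sym eq)))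

  frac-ι : ∀ i j → frac i j * ι (suc j) ≡ ι i
  frac-ι i j = toℚᵘ-injective (begin
    toℚᵘ (frac i j * ι (suc j))               ≈⟨ toℚᵘ-homo-* (frac i j) (ι (suc j)) ⟩
    toℚᵘ (frac i j) ℚᵘ.* toℚᵘ (ι (suc j))     ≈⟨ ℚᵘ.*-cong (toℚᵘ-frac i j) (toℚᵘ-frac (suc j) 0) ⟩
    mkℚᵘ (ℤ.+ i) j ℚᵘ.* mkℚᵘ (ℤ.+ suc j) 0        ≈⟨ ℚᵘ.*≡* (trans (ℤ.*-assoc (ℤ.+ i) (ℤ.+ suc j) (ℤ.+ 1))
                                                   (cong (λ k → ℤ.+ i ℤ.* ℤ.+ k) (trans (ℕ.*-identityʳ (suc j)) (sym (ℕ.*-identityʳ (suc j)))))) ⟩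
    mkℚᵘ (ℤ.+ i) 0                              ≈⟨ toℚᵘ-frac i 0 ⟨
    toℚᵘ (ι i)                                ∎)
    where
    open ℚᵘ.≃-Reasoning
    toℚᵘ-frac : ∀ i j → toℚᵘ (frac i j) ℚᵘ.≃ mkℚᵘ (ℤ.+ i) j
    toℚᵘ-frac i j = subst (λ q → toℚᵘ q ℚᵘ.≃ mkℚᵘ (ℤ.+ i) j) (sym (frac-def i j)) (toℚᵘ-fromℚᵘ (mkℚᵘ (ℤ.+ i) j))

  frac-≤ : ∀ i j {ε} → ι i ≤ ι (suc j) * ε → frac i j ≤ ε
  frac-≤ i j {ε} le = *-cancelʳ-≤-pos (ι (suc j)) {{positive (0<ι-suc j)}}
    (subst₂ _≤_ (sym (frac-ι i j)) (*-comm (ι (suc j)) ε) le)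

  frac-suc : ∀ i j → frac (suc i) j ≡ frac 1 j + frac i j
  frac-suc i j = *-cancelʳ-pos (ι (suc j)) (0<ι-suc j) (begin
    frac (suc i) j * ι (suc j)                        ≡⟨ frac-ι (suc i) j ⟩
    ι (suc i)                                         ≡⟨ ι-suc i ⟩
    1ℚ + ι i                                          ≡⟨ cong₂ _+_ (trans (frac-ι 1 j) ι-one) (frac-ι i j) ⟨
    frac 1 j * ι (suc j) + frac i j * ι (suc j)       ≡⟨ *-distribʳ-+ (ι (suc j)) (frac 1 j) (frac i j) ⟨
    (frac 1 j + frac i j) * ι (suc j)                 ∎)
    where open ≡-Reasoning

  -- `grid` wants a positive real, so a lower bound l₀ is first subtracted from x and added back at
  -- the end, hence the double negation. The bounds found are two grid steps apart, and a step is at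
  -- most ε/2.
  bracket : ∀ x ε → 0ℚ < ε → ∃[ l ] ∃[ u ] Lower x l × Upper x u × u ≤ l + ε
  bracket x ε 0<ε = frac i j - - l₀ , frac (2 ℕ.+ i) j - - l₀ , l , u , (begin
    frac (2 ℕ.+ i) j - - l₀                     ≡⟨ cong (_- - l₀) (trans (frac-suc (suc i) j) (cong (frac 1 j +_) (frac-suc i j))) ⟩
    frac 1 j + (frac 1 j + frac i j) - - l₀     ≡⟨ solve 3 (λ d f l → d :+ (d :+ f) :- :- l := f :- :- l :+ (d :+ d)) refl (frac 1 j) (frac i j) l₀ ⟩
    frac i j - - l₀ + (frac 1 j + frac 1 j)     ≤⟨ +-monoʳ-≤ (frac i j - - l₀) (+-mono-≤ d≤½ε d≤½ε) ⟩
    frac i j - - l₀ + (½ * ε + ½ * ε)           ≡⟨ cong (_+_ (frac i j - - l₀)) (½+½ ε) ⟩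
    frac i j - - l₀ + ε                         ∎)
    where
    open ≤-Reasoning
    l₀ = proj₁ (lower-inhabited x)
    0<x-l₀ : Lower (x ⊕ - l₀) 0ℚ
    0<x-l₀ = subst (Lower x) (solve 1 (λ l → l := con 0ℚ :- :- l) refl l₀) (proj₂ (lower-inhabited x))
    j = proj₁ (archimedean-* 1ℚ (0<½* 0<ε))
    d≤½ε : frac 1 j ≤ ½ * ε
    d≤½ε = frac-≤ 1 j (subst (_≤ ι (suc j) * (½ * ε)) (sym ι-one) (proj₂ (archimedean-* 1ℚ (0<½* 0<ε))))
    i = proj₁ (grid (x ⊕ - l₀) 0<x-l₀ j)
    l = proj₁ (proj₂ (grid (x ⊕ - l₀) 0<x-l₀ j))
    u = proj₂ (proj₂ (grid (x ⊕ - l₀) 0<x-l₀ j))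

  widen : ∀ {x y δ ε} → δ ≤ ε → ∣ x - y ∣< δ → ∣ x - y ∣< ε
  widen {x} {y} δ≤ε ((q , u , l) , (r , u′ , l′)) =
    (q , u , lower-≤ y (+-monoʳ-≤ q (neg-antimono-≤ δ≤ε)) l) ,
    (r , u′ , lower-≤ x (+-monoʳ-≤ r (neg-antimono-≤ δ≤ε)) l′)

  step⇒mono-< : ∀ {f : ℕ → ℕ} → (∀ k → f k ℕ.< f (suc k)) → f Preserves ℕ._<_ ⟶ ℕ._<_
  step⇒mono-< {f} step {i} {suc j} i<1+j with ℕ.m<1+n⇒m<n∨m≡n i<1+j
  ... | inj₁ i<j  = ℕ.<-trans (step⇒mono-< step i<j) (step j)
  ... | inj₂ refl = step j

  choose-below : ∀ {P Q : ℕ → Set} → (∀ k → P k ⊎ Q k) → ∀ n → (∀ k → k ℕ.< n → P k) ⊎ ∃ Q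
  choose-below dec zero    = inj₁ λ _ ()
  choose-below {P} dec (suc n) with choose-below dec n | dec n
  ... | inj₂ found | _       = inj₂ found
  ... | inj₁ _     | inj₂ qn = inj₂ (n , qn)
  ... | inj₁ all   | inj₁ pn = inj₁ below
    where
    below : ∀ k → k ℕ.< suc n → P k
    below k k<1+n with ℕ.m<1+n⇒m<n∨m≡n k<1+n
    ... | inj₁ k<n  = all k k<n
    ... | inj₂ refl = pn

  -- The two nets say that finitely many terms approximate all others from either side; they make
  -- infimum and supremum located. The recurrences provide the two ends of a far walk, and slow
  -- decrease keeps it from leaping over its target.
  record SlowlyRecurrent (c : ℕ → ℝ) : Set where
    field
      below above    : ℚ
      below-lower    : ∀ k → Lower (c k) below
      above-upper    : ∀ k → Upper (c k) above
      slow-decrease  : ∀ ε → 0ℚ < ε → ∃[ N ] ∀ k → N ℕ.≤ k → c k ≤ᴿ c (suc k) ⊕ ε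
      net-below      : ∀ ε → 0ℚ < ε → ∃[ N ] ∀ k → ∃[ j ] j ℕ.< N × c j ≤ᴿ c k ⊕ ε
      net-above      : ∀ ε → 0ℚ < ε → ∃[ N ] ∀ k → ∃[ j ] j ℕ.< N × c k ≤ᴿ c j ⊕ ε
      recurs-above   : ∀ ε → 0ℚ < ε → ∀ k K → ∃[ j ] K ℕ.≤ j × c k ≤ᴿ c j ⊕ ε
      recurs-below   : ∀ ε → 0ℚ < ε → ∀ k K → ∃[ j ] K ℕ.≤ j × c j ≤ᴿ c k ⊕ ε

  -- Infimum, supremum and accumulation points of a slowly recurrent sequence.

  module _ {c : ℕ → ℝ} (slow : SlowlyRecurrent c) where
    open SlowlyRecurrent slow

    -- For q < t < r, the finitely many net terms are located against t < r. One term below r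
    -- settles the matter; if all exceed t, every term exceeds t - (t - q) = q.
    infimum : ℝ
    infimum = cut (λ q → ∀ k → Lower (c k) q) (λ q → ∃[ k ] Upper (c k) q)
      (below , below-lower) (above , 0 , above-upper 0)
      (λ ls (k , u) → <⇒≤ (lower<upper (c k) (ls k) u)) loc
      where
      loc : ∀ {q r} → q < r → (∀ k → Lower (c k) q) ⊎ (∃[ k ] Upper (c k) r)
      loc {q} {r} q<r = let t , q<t , t<r = <-dense q<r in decide t q<t t<r
        where
        decide : ∀ t → q < t → t < r → (∀ k → Lower (c k) q) ⊎ (∃[ k ] Upper (c k) r)
        decide t q<t t<r with net-below (t - q) (0<q-p q<t)
        ... | N , net with choose-below (λ k → located (c k) t<r) N
        ... | inj₂ found = inj₂ found
        ... | inj₁ all   = inj₁ λ k → let j , j<N , cj≤ck = net k in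
                subst (Lower (c k)) (solve 2 (λ t q → t :- (t :- q) := q) refl t q) (cj≤ck (all j j<N))

    supremum : ℝ
    supremum = cut (λ q → ∃[ k ] Lower (c k) q) (λ q → ∀ k → Upper (c k) q)
      (below , 0 , below-lower 0) (above , above-upper)
      (λ (k , l) us → <⇒≤ (lower<upper (c k) l (us k))) loc
      where
      loc : ∀ {q r} → q < r → (∃[ k ] Lower (c k) q) ⊎ (∀ k → Upper (c k) r)
      -- Net terms are located against q < t, the net has tolerance v - t, and the gap from v to r
      -- pays for moving upper bounds across `≤ᴿ`.
      loc {q} {r} q<r = let t , q<t , t<r = <-dense q<r ; v , t<v , v<r = <-dense t<r in decide t v q<t t<v v<r
        where
        decide : ∀ t v → q < t → t < v → v < r → (∃[ k ] Lower (c k) q) ⊎ (∀ k → Upper (c k) r)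
        decide t v q<t t<v v<r with net-above (v - t) (0<q-p t<v)
        ... | N , net with choose-below (λ k → swap (located (c k) q<t)) N
        ... | inj₂ found = inj₁ found
        ... | inj₁ all   = inj₂ λ k → let j , j<N , ck≤cj = net k in
                shift-upper {c k} {c j} (v - t) ck≤cj
                  (subst (_< r) (solve 2 (λ t v → v := t :+ (v :- t)) refl t v) v<r) (all j j<N)

    infimum≤ : ∀ k → infimum ≤ᴿ c k
    infimum≤ k (r , q<r , ls) = lower-closed (c k) q<r (ls k)

    infimum-greatest : ∀ y → (∀ k → y ≤ᴿ c k) → y ≤ᴿ infimum
    infimum-greatest y y≤c l = let r , q<r , l′ = lower-open y l in r , q<r , λ k → y≤c k l′

    ≤supremum : ∀ k → c k ≤ᴿ supremum
    ≤supremum k l = let r , q<r , l′ = lower-open (c k) l in r , q<r , k , l′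

    supremum-least : ∀ y → (∀ k → c k ≤ᴿ y) → supremum ≤ᴿ y
    supremum-least y c≤y (r , q<r , k , l) = lower-closed y q<r (c≤y k l)

    -- A discrete intermediate value theorem: stop at the first term below v; the
    -- term before it is above u, so that a drop of at most δ keeps it above u - δ.
    crossing : ∀ {N δ t u v} → (∀ k → N ℕ.≤ k → c k ≤ᴿ c (suc k) ⊕ δ) → t ≤ u - δ → u < v →
               ∀ i j → N ℕ.≤ i → Lower (c i) t → Upper (c (j ℕ.+ i)) u →
               ∃[ k ] i ℕ.≤ k × Lower (c k) t × Upper (c k) v
    crossing step t≤ u<v i zero N≤i l u′ = i , ℕ.≤-refl , l , upper-closed (c i) u<v u′
    crossing {u = u} step t≤ u<v i (suc j) N≤i l u′ with located (c i) u<v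
    ... | inj₂ u″ = i , ℕ.≤-refl , l , u″
    ... | inj₁ l′ = let k , i<k , found = crossing step t≤ u<v (suc i) j (ℕ.m≤n⇒m≤1+n N≤i)
                                            (lower-≤ (c (suc i)) t≤ (step i N≤i l′))
                                            (subst (λ e → Upper (c e) u) (sym (ℕ.+-suc j i)) u′)
                    in k , ℕ.<⇒≤ i<k , found

    -- x is enclosed between l and u ≤ l + δ, where δ = ε/8. Recurrence gives a far i with c i > l -
    -- δ and a later j with c j < w = u + 3δ: one δ for approximating the infimum, one for the
    -- recurrence, one to spare. The walk then meets a term between l - δ and w + δ ≤ l + 5δ.
    near : ∀ x → x ∈[ infimum , supremum ] → ∀ ε → 0ℚ < ε → ∀ K → ∃[ k ] K ℕ.≤ k × ∣ c k - x ∣< ε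
    near x (inf≤x , x≤sup) ε 0<ε K =
      let l , u , lower-l , upper-u , u≤l+δ = bracket x δ 0<δ
          r , l<r , k₁ , lower-r            = x≤sup lower-l
          q , q<u+δ , k₂ , upper-q          = upper-<-respʳ {infimum} {x} inf≤x (p<p+q u 0<δ) upper-u
          N , step                          = slow-decrease δ 0<δ
          i , KN≤i , ck₁≤ci                 = recurs-above δ 0<δ k₁ (K ℕ.⊔ N)
          j , i≤j , cj≤ck₂                  = recurs-below δ 0<δ k₂ i
          w                                 = u + δ + 2δ
          k , i≤k , lower-k , upper-k       = crossing {N} {δ} {l - δ} {w} {w + δ} step
            (begin
              l - δ           ≤⟨ +-monoˡ-≤ (- δ) (<⇒≤ (lower<upper x lower-l upper-u)) ⟩
              u - δ           ≤⟨ +-monoˡ-≤ (- δ) (<⇒≤ (<-trans (p<p+q u 0<δ) (p<p+q (u + δ) 0<2δ))) ⟩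
              w - δ           ∎)
            (p<p+q w 0<δ) i (j ℕ.∸ i) (ℕ.≤-trans (ℕ.m≤n⊔m K N) KN≤i)
            (ck₁≤ci (lower-closed (c k₁) l<r lower-r))
            (subst (λ e → Upper (c e) w) (sym (ℕ.m∸n+n≡m i≤j))
              (shift-upper {c j} {c k₂} δ cj≤ck₂
                (subst (q + δ <_) (solve 2 (λ u d → u :+ d :+ d :+ d := u :+ d :+ (d :+ d)) refl u δ)
                  (<-trans (+-monoˡ-< δ q<u+δ) (p<p+q (u + δ + δ) 0<δ))) upper-q))
      in k , ℕ.≤-trans (ℕ.m≤m⊔n K N) (ℕ.≤-trans KN≤i i≤k) ,
         (w + δ , upper-k , lower-≤ x (begin
           w + δ - ε                 ≤⟨ +-monoˡ-≤ (- ε) (+-monoˡ-≤ δ (+-monoˡ-≤ 2δ (+-monoˡ-≤ δ u≤l+δ))) ⟩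
           l + δ + δ + 2δ + δ - ε    ≡⟨ solve 2 (λ l e → let d = con ½ :* (con ½ :* (con ½ :* e)) in
                                         l :+ d :+ d :+ (d :+ d) :+ d :- e := l :- (d :+ (d :+ d))) refl l ε ⟩
           l - (δ + 2δ)              ≤⟨ <⇒≤ (p-q<p l (+-mono-< 0<δ 0<2δ)) ⟩
           l                         ∎) lower-l) ,
         (u , upper-u , lower-≤ (c k) (begin
           u - ε                     ≤⟨ +-monoˡ-≤ (- ε) u≤l+δ ⟩
           l + δ - ε                 ≡⟨ solve 2 (λ l e → let d = con ½ :* (con ½ :* (con ½ :* e)) in
                                         l :+ d :- e := l :- d :- (d :+ d :+ (d :+ d) :+ (d :+ d))) refl l ε ⟩
           l - δ - (2δ + 2δ + 2δ)    ≤⟨ <⇒≤ (p-q<p (l - δ) (+-mono-< (+-mono-< 0<2δ 0<2δ) 0<2δ)) ⟩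
           l - δ                     ∎) lower-k)
      where
      open ≤-Reasoning
      δ  = ½ * (½ * (½ * ε))
      2δ = δ + δ
      0<δ : 0ℚ < δ
      0<δ = 0<½* (0<½* (0<½* 0<ε))
      0<2δ : 0ℚ < 2δ
      0<2δ = +-mono-< 0<δ 0<δ

    accumulates : ∀ x → x ∈[ infimum , supremum ] →
                  Σ[ ν ∈ (ℕ → ℕ) ] (ν Preserves ℕ._<_ ⟶ ℕ._<_) × (c ∘ ν) ConvergesTo x
    accumulates x x∈ = ν , step⇒mono-< (λ j → proj₁ (proj₂ (find (suc j) (suc (ν j))))) ,
      λ ε 0<ε → let K , 1≤Kε = archimedean-* 1ℚ 0<ε in
        K , λ k K≤k → widen {c (ν k)} {x} (≤-trans (frac-mono-≤ (ℕ.*-monoʳ-≤ 1 (s≤s K≤k)))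
          (frac-≤ 1 K (subst (_≤ ι (suc K) * ε) (sym ι-one) 1≤Kε))) (ν-near k)
      where
      0<frac1 : ∀ j → 0ℚ < frac 1 j
      0<frac1 j = subst (_< frac 1 j) (frac-zero j) (frac-mono-< (s≤s z≤n))
      find : ∀ j K → ∃[ k ] K ℕ.≤ k × ∣ c k - x ∣< frac 1 j
      find j = near x x∈ (frac 1 j) (0<frac1 j)
      ν : ℕ → ℕ
      ν zero    = proj₁ (find 0 0)
      ν (suc j) = proj₁ (find (suc j) (suc (ν j)))
      ν-near : ∀ j → ∣ c (ν j) - x ∣< frac 1 j
      ν-near zero    = proj₂ (proj₂ (find 0 0))
      ν-near (suc j) = proj₂ (proj₂ (find (suc j) (suc (ν j))))

  -- A lower bound q can be raised to some r > q, and r - q absorbs the tolerance of the limit; a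
  -- single late term then transfers the bound.
  limit∈ : ∀ {c : ℕ → ℝ} {m M x} → (∀ k → c k ∈[ m , M ]) → c ConvergesTo x → x ∈[ m , M ]
  limit∈ {c} {m} {M} {x} bounds lim = m≤x , x≤M
    where
    cancel : ∀ q r → r - (r - q) ≡ q
    cancel = solve 2 (λ q r → r :- (r :- q) := q) refl

    m≤x : m ≤ᴿ x
    m≤x {q} l with lower-open m l
    ... | r , q<r , l′ with lim (r - q) (0<q-p q<r)
    ... | K , close with close K ℕ.≤-refl
    ... | (t , u , l″) , _ = lower-≤ x (subst (_≤ t - (r - q)) (cancel q r)
            (+-monoˡ-≤ (- (r - q)) (<⇒≤ (lower<upper (c K) (proj₁ (bounds K) l′) u)))) l″

    x≤M : x ≤ᴿ M
    x≤M {q} l with lower-open x l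
    ... | r , q<r , l′ with lim (r - q) (0<q-p q<r)
    ... | K , close with close K ℕ.≤-refl
    ... | _ , (t , u , l″) = proj₂ (bounds K) (lower-≤ (c K) (subst (_≤ t - (r - q)) (cancel q r)
            (+-monoˡ-≤ (- (r - q)) (<⇒≤ (lower<upper x l′ u)))) l″)

  -- Arithmetic of `ι` and inequalities for rational powers.

  ι-+ : ∀ m n → ι (m ℕ.+ n) ≡ ι m + ι n
  ι-+ zero    n = trans (sym (+-identityˡ (ι n))) (cong (_+ ι n) (sym ι-zero))
  ι-+ (suc m) n = begin
    ι (suc (m ℕ.+ n))     ≡⟨ ι-suc (m ℕ.+ n) ⟩
    1ℚ + ι (m ℕ.+ n)      ≡⟨ cong (1ℚ +_) (ι-+ m n) ⟩
    1ℚ + (ι m + ι n)      ≡⟨ +-assoc 1ℚ (ι m) (ι n) ⟨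
    1ℚ + ι m + ι n        ≡⟨ cong (_+ ι n) (ι-suc m) ⟨
    ι (suc m) + ι n       ∎
    where open ≡-Reasoning

  ι-* : ∀ m n → ι (m ℕ.* n) ≡ ι m * ι n
  ι-* zero    n = trans ι-zero (trans (sym (*-zeroˡ (ι n))) (cong (_* ι n) (sym ι-zero)))
  ι-* (suc m) n = begin
    ι (n ℕ.+ m ℕ.* n)       ≡⟨ ι-+ n (m ℕ.* n) ⟩
    ι n + ι (m ℕ.* n)       ≡⟨ cong (ι n +_) (ι-* m n) ⟩
    ι n + ι m * ι n         ≡⟨ solve 2 (λ m n → n :+ m :* n := (con 1ℚ :+ m) :* n) refl (ι m) (ι n) ⟩
    (1ℚ + ι m) * ι n        ≡⟨ cong (_* ι n) (ι-suc m) ⟨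
    ι (suc m) * ι n         ∎
    where open ≡-Reasoning

  ι-^ : ∀ m k → ι (m ℕ.^ k) ≡ ι m ^ k
  ι-^ m zero    = ι-one
  ι-^ m (suc k) = trans (ι-* m (m ℕ.^ k)) (cong (ι m *_) (ι-^ m k))

  0≤frac : ∀ i j → 0ℚ ≤ frac i j
  0≤frac i j = subst (_≤ frac i j) (frac-zero j) (frac-mono-≤ z≤n)

  ^-cancel-≤ : ∀ {q r} k → 0ℚ ≤ r → q ^ suc k ≤ r ^ suc k → q ≤ r
  ^-cancel-≤ {q} {r} k 0≤r le with q ≤? r
  ... | yes q≤r = q≤r
  ... | no  q≰r = contradiction (<-≤-trans (^-mono-< k 0≤r (≰⇒> q≰r)) le) (<-irrefl refl)

  -- Bernoulli's inequality for 1/(1 + d)^k, free of division. The induction rests on (1 - (k+1)d)(1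
  -- + d) = 1 - kd - (k+1)d².
  [1-kd][1+d]^k≤1 : ∀ {d} → 0ℚ ≤ d → ∀ k → (1ℚ - ι k * d) * (1ℚ + d) ^ k ≤ 1ℚ
  [1-kd][1+d]^k≤1 {d} 0≤d zero = ≤-reflexive (trans (cong (λ z → (1ℚ - z * d) * 1ℚ) ι-zero)
    (solve 1 (λ d → (con 1ℚ :- con 0ℚ :* d) :* con 1ℚ := con 1ℚ) refl d))
  [1-kd][1+d]^k≤1 {d} 0≤d (suc k) = begin
    (1ℚ - ι (suc k) * d) * ((1ℚ + d) * (1ℚ + d) ^ k)
      ≡⟨ cong (λ z → (1ℚ - z * d) * ((1ℚ + d) * (1ℚ + d) ^ k)) (ι-suc k) ⟩
    (1ℚ - (1ℚ + ι k) * d) * ((1ℚ + d) * (1ℚ + d) ^ k)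
      ≡⟨ solve 3 (λ d n x → (con 1ℚ :- (con 1ℚ :+ n) :* d) :* ((con 1ℚ :+ d) :* x)
                         := (con 1ℚ :- n :* d :+ :- ((con 1ℚ :+ n) :* (d :* d))) :* x) refl d (ι k) ((1ℚ + d) ^ k) ⟩
    (1ℚ - ι k * d + - ((1ℚ + ι k) * (d * d))) * (1ℚ + d) ^ k
      ≤⟨ *-monoʳ-≤-nonNeg ((1ℚ + d) ^ k) {{nonNegative (^-nonNeg k 0≤1+d)}}
           (≤-trans (+-monoʳ-≤ (1ℚ - ι k * d) (neg-antimono-≤ 0≤square)) (≤-reflexive (+-identityʳ (1ℚ - ι k * d)))) ⟩
    (1ℚ - ι k * d) * (1ℚ + d) ^ k
      ≤⟨ [1-kd][1+d]^k≤1 0≤d k ⟩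
    1ℚ ∎
    where
    open ≤-Reasoning
    0≤1+d : 0ℚ ≤ 1ℚ + d
    0≤1+d = +-mono-≤ (<⇒≤ (positive⁻¹ 1ℚ)) 0≤d
    0≤square : 0ℚ ≤ (1ℚ + ι k) * (d * d)
    0≤square = *-mono-≤-nonNeg {0ℚ} {_} {0ℚ} ≤-refl ≤-refl (+-mono-≤ (<⇒≤ (positive⁻¹ 1ℚ)) (0≤ι k))
      (*-mono-≤-nonNeg {0ℚ} {_} {0ℚ} ≤-refl ≤-refl 0≤d 0≤d)

  *-pos : ∀ {q r} → 0ℚ < q → 0ℚ < r → 0ℚ < q * r
  *-pos {q} {r} 0<q 0<r = subst (_< q * r) (*-zeroʳ q) (*-monoʳ-<-pos q {{positive 0<q}} 0<r)

  -- y ≤[ ρ ] x says y ≤ ρ x.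
  infix 4 _≤[_]_
  record _≤[_]_ (y : ℝ) (ρ : ℚ) (x : ℝ) : Set where
    constructor scale
    field upper-scale : ∀ {u} → Upper x u → Upper y (ρ * u)

  open _≤[_]_

  ≤[]-trans : ∀ {x y z σ ρ} → z ≤[ σ ] y → y ≤[ ρ ] x → z ≤[ σ * ρ ] x
  ≤[]-trans {z = z} {σ} {ρ} z≤y y≤x = scale λ {u} upper →
    subst (Upper z) (sym (*-assoc σ ρ u)) (upper-scale z≤y (upper-scale y≤x upper))

  -- Comparing real powers, quotients and the logarithm.

  module _ (α : ℝ) (0<α : Lower α 0ℚ) {x y : ℚ} (1≤x : 1ℚ ≤ x) (1≤y : 1ℚ ≤ y) where

    -- Upper bounds of x^α come from exponents above α, while the hypothesis speaks of exponents
    -- below it. So the argument is indirect: a lower bound r > ρ v of y^α would make r/ρ > v a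
    -- lower bound of x^α, although v is an upper one.
    pow-≤-lower : ∀ {ρ} → 0ℚ < ρ → (∀ i j → Lower α (frac i j) → y ^ i ≤ ρ ^ suc j * x ^ i) →
                  pow y 1≤y α 0<α ≤[ ρ ] pow x 1≤x α 0<α
    pow-≤-lower {ρ} 0<ρ bound = scale below
      where
      open ≤-Reasoning
      below : ∀ {u} → Upper (pow x 1≤x α 0<α) u → Upper (pow y 1≤y α 0<α) (ρ * u)
      below {u} upper with upper-open (pow x 1≤x α 0<α) upper
      ... | v , v<u , upper-v with located (pow y 1≤y α 0<α) (*-monoʳ-<-pos ρ {{positive 0<ρ}} v<u)
      ... | inj₂ upper-ρu = upper-ρu
      ... | inj₁ (r , ρv<r , i , j , i/j<α , r^j≤y^i) = contradiction upper-v (disjoint (pow x 1≤x α 0<α)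
        (r′ , *-cancelˡ-<-nonNeg ρ {{nonNegative (<⇒≤ 0<ρ)}} (subst (ρ * v <_) (sym ρr′≡r) ρv<r) , i , j , i/j<α ,
         *-cancelˡ-≤-pos (ρ ^ suc j) {{positive (^-pos (suc j) 0<ρ)}} (begin
           ρ ^ suc j * r′ ^ suc j    ≡⟨ ^-distrib-* ρ r′ (suc j) ⟨
           (ρ * r′) ^ suc j          ≡⟨ cong (_^ suc j) ρr′≡r ⟩
           r ^ suc j                 ≤⟨ r^j≤y^i ⟩
           y ^ i                     ≤⟨ bound i j i/j<α ⟩
           ρ ^ suc j * x ^ i         ∎)))
        where
        r′ = r * recip ρ 0<ρ
        ρr′≡r : ρ * r′ ≡ r
        ρr′≡r = trans (*-comm ρ r′) (recip-cancel r ρ 0<ρ)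

    -- Here the exponents lie above α, so each upper bound q of x^α yields q/σ for y^α directly.
    pow-≤-upper : ∀ {σ} (0<σ : 0ℚ < σ) → (∀ i j → Upper α (frac i j) → σ ^ suc j * y ^ i ≤ x ^ i) →
                  pow y 1≤y α 0<α ≤[ recip σ 0<σ ] pow x 1≤x α 0<α
    pow-≤-upper {σ} 0<σ bound = scale λ { {u} (q , q<u , 0<q , i , j , α<i/j , x^i≤q^j) →
      ρ * q , *-monoʳ-<-pos ρ {{positive 0<ρ}} q<u ,
      subst (_< ρ * q) (*-zeroʳ ρ) (*-monoʳ-<-pos ρ {{positive 0<ρ}} 0<q) , i , j , α<i/j ,
      *-cancelˡ-≤-pos (σ ^ suc j) {{positive (^-pos (suc j) 0<σ)}} (begin
        σ ^ suc j * y ^ i            ≤⟨ bound i j α<i/j ⟩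
        x ^ i                        ≤⟨ x^i≤q^j ⟩
        q ^ suc j                    ≡⟨ cong (_^ suc j) (q≡σρq q) ⟩
        (σ * (ρ * q)) ^ suc j        ≡⟨ ^-distrib-* σ (ρ * q) (suc j) ⟩
        σ ^ suc j * (ρ * q) ^ suc j  ∎) }
      where
      open ≤-Reasoning
      ρ = recip σ 0<σ
      0<ρ = 0<recip σ 0<σ
      q≡σρq : ∀ q → q ≡ σ * (ρ * q)
      q≡σρq q = trans (sym (recip-cancel q σ 0<σ)) (trans (*-comm (q * ρ) σ) (cong (σ *_) (*-comm q ρ)))

  upper-pow-≥ : ∀ α 0<α {x} 1≤x {σ u} → (∀ i j → Upper α (frac i j) → σ ^ suc j ≤ x ^ i) →
                Upper (pow x 1≤x α 0<α) u → σ < u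
  upper-pow-≥ α 0<α 1≤x bound (q , q<u , 0<q , i , j , α<i/j , x^i≤q^j) =
    ≤-<-trans (^-cancel-≤ j (<⇒≤ 0<q) (≤-trans (bound i j α<i/j) x^i≤q^j)) q<u

  -- In real terms κ (a/y) ≤ a′/y′. The extra r ≤ κ q lets the caller replace the factor κ by a
  -- subtracted error.
  quotient-compare : ∀ {a a′ y y′} 0<y 0<y′ {ρ κ q r} → 0ℚ < ρ → y′ ≤[ ρ ] y → 0ℚ < κ → κ * (ρ * ι a) ≤ ι a′ → r ≤ κ * q →
                     Lower (quotient a y 0<y) q → Lower (quotient a′ y′ 0<y′) r
  quotient-compare {a} {a′} 0<y 0<y′ {ρ} {κ} 0<ρ y′≤ρy 0<κ κρa≤a′ r≤κq (t , q<t , u , upper-u , tu≤a) =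
    κ * t , ≤-<-trans r≤κq (*-monoʳ-<-pos κ {{positive 0<κ}} q<t) , ρ * u , upper-scale y′≤ρy upper-u , (begin
      κ * t * (ρ * u)     ≡⟨ solve 4 (λ k t r u → k :* t :* (r :* u) := k :* (r :* (t :* u))) refl κ t ρ u ⟩
      κ * (ρ * (t * u))   ≤⟨ *-monoˡ-≤-nonNeg κ {{nonNegative (<⇒≤ 0<κ)}} (*-monoˡ-≤-nonNeg ρ {{nonNegative (<⇒≤ 0<ρ)}} tu≤a) ⟩
      κ * (ρ * ι a)       ≤⟨ κρa≤a′ ⟩
      ι a′                ∎)
    where open ≤-Reasoning

  -- A cut remembers a witness for some fraction, not for this i and j. The integer inequality is
  -- decidable, and its failure would make i/j an upper bound of the logarithm, against the room
  -- above a strict lower bound.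
  log-lower : ∀ s p 2≤s 1≤p i j → Lower (log s p 2≤s 1≤p) (frac i j) → s ℕ.^ i ℕ.≤ p ℕ.^ suc j
  log-lower s p 2≤s 1≤p i j l with s ℕ.^ i ℕ.≤? p ℕ.^ suc j
  ... | yes le = le
  ... | no  gt = let r , i/j<r , l′ = lower-open (log s p 2≤s 1≤p) l in
    contradiction (frac i j , i/j<r , i , j , ≤-refl , ℕ.<⇒≤ (ℕ.≰⇒> gt)) (disjoint (log s p 2≤s 1≤p) l′)

  log-upper : ∀ s p 2≤s 1≤p i j → Upper (log s p 2≤s 1≤p) (frac i j) → p ℕ.^ suc j ℕ.≤ s ℕ.^ i
  log-upper s p 2≤s 1≤p i j u with p ℕ.^ suc j ℕ.≤? s ℕ.^ i
  ... | yes le = le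
  ... | no  gt = let r , r<i/j , u′ = upper-open (log s p 2≤s 1≤p) u in
    contradiction u′ (disjoint (log s p 2≤s 1≤p) (frac i j , r<i/j , i , j , ≤-refl , ℕ.<⇒≤ (ℕ.≰⇒> gt)))

  n<m^n : ∀ {m} → 2 ℕ.≤ m → ∀ n → n ℕ.< m ℕ.^ n
  n<m^n 2≤m zero    = s≤s z≤n
  n<m^n {m} 2≤m (suc n) = ℕ.≤-<-trans (n<m^n 2≤m n) (ℕ.^-monoʳ-< m 2≤m (ℕ.n<1+n n))

  ℕ-^-distribʳ-* : ∀ i x y → (x ℕ.* y) ℕ.^ i ≡ x ℕ.^ i ℕ.* y ℕ.^ i
  ℕ-^-distribʳ-* zero    x y = refl
  ℕ-^-distribʳ-* (suc i) x y = trans (cong (x ℕ.* y ℕ.*_) (ℕ-^-distribʳ-* i x y)) (interchange x y (x ℕ.^ i) (y ℕ.^ i))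

  ^-swap : ∀ x i j → (x ℕ.^ i) ℕ.^ j ≡ (x ℕ.^ j) ℕ.^ i
  ^-swap x i j = trans (ℕ.^-*-assoc x i j) (trans (cong (x ℕ.^_) (ℕ.*-comm i j)) (sym (ℕ.^-*-assoc x j i)))

  -- The sequence (b_n), with index shifted to start at 0.

  module ValueSequence {p s : ℕ} (2≤s : 2 ℕ.≤ s) (s<p : s ℕ.< p)
           {A : Subset p} (h : Fin s ⤖ ∃ (_∈ A)) (h-increasing : StrictlyIncreasing h) where

    c : ℕ → ℝ
    c k = b h 2≤s s<p (suc k)

    α : ℝ
    α = log s p 2≤s (ℕ.≤-trans (s≤s z≤n) s<p)

    0<α : Lower α 0ℚ
    0<α = 0<log s p 2≤s (ℕ.≤-trans (s≤s z≤n) s<p) (ℕ.<⇒≤ s<p)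

    P : ℕ → ℝ
    P k = pow (ι (suc k)) (1≤ι (suc k)) α 0<α

    open Digits 2≤s h h-increasing

    -- p ≤ s^p gives α ≤ p; the cut records strict bounds, hence p + 1.
    α<1+p : Upper α (ι (suc p))
    α<1+p = frac p 0 , frac-mono-< (ℕ.*-monoˡ-< 1 (ℕ.n<1+n p)) , p , 0 , ≤-refl , p^1≤s^p
      where
      p^1≤s^p : p ℕ.^ 1 ℕ.≤ s ℕ.^ p
      p^1≤s^p = ℕ.≤-trans (ℕ.≤-reflexive (ℕ.^-identityʳ p)) (ℕ.<⇒≤ (n<m^n 2≤s p))

    K : ℕ
    K = suc p

    0<ιp^ : ∀ j → 0ℚ < ι (p ℕ.^ j)
    0<ιp^ j = <-≤-trans (positive⁻¹ 1ℚ) (1≤ι (p ℕ.^ j) {{ℕ.m^n≢0 p j {{ℕ.>-nonZero (ℕ.≤-<-trans z≤n s<p)}}}})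

    1/p^ : ℕ → ℚ
    1/p^ j = recip (ι (p ℕ.^ j)) (0<ιp^ j)

    -- A rational bound for ((k + 2)/(k + 1))^α, because K > α.
    growth : ℕ → ℚ
    growth k = (1ℚ + frac 1 k) ^ K

    1≤1+frac : ∀ k → 1ℚ ≤ 1ℚ + frac 1 k
    1≤1+frac k = subst (_≤ 1ℚ + frac 1 k) (+-identityʳ 1ℚ) (+-monoʳ-≤ 1ℚ (0≤frac 1 k))

    1≤growth : ∀ k → 1ℚ ≤ growth k
    1≤growth k = ^-mono-exponent {i = 0} {K} (1≤1+frac k) z≤n

    0<growth : ∀ k → 0ℚ < growth k
    0<growth k = <-≤-trans (positive⁻¹ 1ℚ) (1≤growth k)

    open ≤-Reasoning

    -- If i/m < α then s^i ≤ p^m, so (s^j)^i = (s^i)^j ≤ (p^j)^m. This is one half of (s^j n)^α =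
    -- p^j n^α; exponents above α give the other.
    pow-block-≤ : ∀ j {k l} → suc l ℕ.≤ s ℕ.^ j ℕ.* suc k → P l ≤[ ι (p ℕ.^ j) ] P k
    pow-block-≤ j {k} {l} l≤ = pow-≤-lower α 0<α (1≤ι _) (1≤ι _) (0<ιp^ j) λ i m i/m<α → begin
      ι (suc l) ^ i                                        ≡⟨ ι-^ (suc l) i ⟨
      ι (suc l ℕ.^ i)                                      ≤⟨ ι-mono-≤ (bound i m (log-lower s p 2≤s (ℕ.≤-trans (s≤s z≤n) s<p) i m i/m<α)) ⟩
      ι ((p ℕ.^ j) ℕ.^ suc m ℕ.* suc k ℕ.^ i)              ≡⟨ ι-* ((p ℕ.^ j) ℕ.^ suc m) (suc k ℕ.^ i) ⟩
      ι ((p ℕ.^ j) ℕ.^ suc m) * ι (suc k ℕ.^ i)            ≡⟨ cong₂ _*_ (ι-^ (p ℕ.^ j) (suc m)) (ι-^ (suc k) i) ⟩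
      ι (p ℕ.^ j) ^ suc m * ι (suc k) ^ i                  ∎
      where
      bound : ∀ i m → s ℕ.^ i ℕ.≤ p ℕ.^ suc m → suc l ℕ.^ i ℕ.≤ (p ℕ.^ j) ℕ.^ suc m ℕ.* suc k ℕ.^ i
      bound i m s^i≤p^m = ℕR.begin
        suc l ℕ.^ i                                        ℕR.≤⟨ ℕ.^-monoˡ-≤ i l≤ ⟩
        (s ℕ.^ j ℕ.* suc k) ℕ.^ i                          ℕR.≡⟨ ℕ-^-distribʳ-* i (s ℕ.^ j) (suc k) ⟩
        (s ℕ.^ j) ℕ.^ i ℕ.* suc k ℕ.^ i                    ℕR.≡⟨ cong (ℕ._* suc k ℕ.^ i) (^-swap s j i) ⟩
        (s ℕ.^ i) ℕ.^ j ℕ.* suc k ℕ.^ i                    ℕR.≤⟨ ℕ.*-monoˡ-≤ (suc k ℕ.^ i) (ℕ.^-monoˡ-≤ j s^i≤p^m) ⟩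
        (p ℕ.^ suc m) ℕ.^ j ℕ.* suc k ℕ.^ i                ℕR.≡⟨ cong (ℕ._* suc k ℕ.^ i) (^-swap p (suc m) j) ⟩
        (p ℕ.^ j) ℕ.^ suc m ℕ.* suc k ℕ.^ i                ℕR.∎
        where module ℕR = ℕ.≤-Reasoning

    -- Kept as a statement on rational powers because it serves twice: for a bound between two reals
    -- in `pow-block-≥`, and for a rational bound of one real in `c-≤`.
    pow-block-≥′ : ∀ j {k l} → s ℕ.^ j ℕ.* suc k ℕ.≤ suc l → ∀ i m → Upper α (frac i m) →
                   ι (p ℕ.^ j) ^ suc m * ι (suc k) ^ i ≤ ι (suc l) ^ i
    pow-block-≥′ j {k} {l} ≤l i m α<i/m = begin
      ι (p ℕ.^ j) ^ suc m * ι (suc k) ^ i                  ≡⟨ cong₂ _*_ (ι-^ (p ℕ.^ j) (suc m)) (ι-^ (suc k) i) ⟨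
      ι ((p ℕ.^ j) ℕ.^ suc m) * ι (suc k ℕ.^ i)            ≡⟨ ι-* ((p ℕ.^ j) ℕ.^ suc m) (suc k ℕ.^ i) ⟨
      ι ((p ℕ.^ j) ℕ.^ suc m ℕ.* suc k ℕ.^ i)              ≤⟨ ι-mono-≤ (bound (log-upper s p 2≤s (ℕ.≤-trans (s≤s z≤n) s<p) i m α<i/m)) ⟩
      ι (suc l ℕ.^ i)                                      ≡⟨ ι-^ (suc l) i ⟩
      ι (suc l) ^ i                                        ∎
      where
      bound : p ℕ.^ suc m ℕ.≤ s ℕ.^ i → (p ℕ.^ j) ℕ.^ suc m ℕ.* suc k ℕ.^ i ℕ.≤ suc l ℕ.^ i
      bound p^m≤s^i = ℕR.begin
        (p ℕ.^ j) ℕ.^ suc m ℕ.* suc k ℕ.^ i                ℕR.≡⟨ cong (ℕ._* suc k ℕ.^ i) (^-swap p j (suc m)) ⟩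
        (p ℕ.^ suc m) ℕ.^ j ℕ.* suc k ℕ.^ i                ℕR.≤⟨ ℕ.*-monoˡ-≤ (suc k ℕ.^ i) (ℕ.^-monoˡ-≤ j p^m≤s^i) ⟩
        (s ℕ.^ i) ℕ.^ j ℕ.* suc k ℕ.^ i                    ℕR.≡⟨ cong (ℕ._* suc k ℕ.^ i) (^-swap s i j) ⟩
        (s ℕ.^ j) ℕ.^ i ℕ.* suc k ℕ.^ i                    ℕR.≡⟨ ℕ-^-distribʳ-* i (s ℕ.^ j) (suc k) ⟨
        (s ℕ.^ j ℕ.* suc k) ℕ.^ i                          ℕR.≤⟨ ℕ.^-monoˡ-≤ i ≤l ⟩
        suc l ℕ.^ i                                        ℕR.∎
        where module ℕR = ℕ.≤-Reasoning

    pow-block-≥ : ∀ j {k l} → s ℕ.^ j ℕ.* suc k ℕ.≤ suc l → P k ≤[ 1/p^ j ] P l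
    pow-block-≥ j ≤l = pow-≤-upper α 0<α (1≤ι _) (1≤ι _) (0<ιp^ j) (pow-block-≥′ j ≤l)

    pow-suc : ∀ k → P (suc k) ≤[ growth k ] P k
    pow-suc k = pow-≤-lower α 0<α (1≤ι _) (1≤ι _) (0<growth k) λ i m i/m<α → begin
      ι (suc (suc k)) ^ i                               ≡⟨ cong (_^ i) 1+k ⟩
      (g * ι (suc k)) ^ i                               ≡⟨ ^-distrib-* g (ι (suc k)) i ⟩
      g ^ i * ι (suc k) ^ i                             ≤⟨ *-monoʳ-≤-nonNeg (ι (suc k) ^ i) {{nonNegative (^-nonNeg i (0≤ι (suc k)))}}
                                                             (^-mono-exponent (1≤1+frac k) (i≤ i m i/m<α)) ⟩
      g ^ (K ℕ.* suc m) * ι (suc k) ^ i                 ≡⟨ cong (_* ι (suc k) ^ i) (^-assocʳ g K (suc m)) ⟨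
      growth k ^ suc m * ι (suc k) ^ i                  ∎
      where
      g = 1ℚ + frac 1 k
      i≤ : ∀ i m → Lower α (frac i m) → i ℕ.≤ K ℕ.* suc m
      i≤ i m l = ℕ.<⇒≤ (subst (ℕ._< K ℕ.* suc m) (ℕ.*-identityʳ i) (frac-cancel-< (lower<upper α l α<1+p)))
      1+k : ι (suc (suc k)) ≡ g * ι (suc k)
      1+k = trans (ι-suc (suc k)) (sym (trans (*-distribʳ-+ (ι (suc k)) 1ℚ (frac 1 k))
        (trans (+-comm (1ℚ * ι (suc k)) (frac 1 k * ι (suc k)))
          (cong₂ _+_ (trans (frac-ι 1 k) ι-one) (*-identityˡ (ι (suc k)))))))

    -- Boundedness of (b_n), and factors turned into additive errors.

    B : ℕ
    B = suc (a₀ s)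

    -- If n = k + 1 has leading digit d at place j, then n^α ≥ p^j because d ≥ 1, and a_n < p^j (a_d
    -- + 1) ≤ p^j B because d < s.
    c-≤ : ∀ k {q} → Lower (c k) q → q ≤ ι B
    c-≤ k {q} (t , q<t , u , upper-u , tu≤a) with block-prefix s 2≤s 1 (suc k) (s≤s z≤n)
    ... | j , suc m , _ , m<s , m≤k , k<m+1 = <⇒≤ (<-≤-trans q<t (*-cancelʳ-≤-pos u {{positive (<-trans (0<ιp^ j) p^j<u)}} (begin
      t * u                           ≤⟨ tu≤a ⟩
      ι (a₀ (suc k))                  ≤⟨ ι-mono-≤ (ℕ.≤-trans (ℕ.<⇒≤ (a₀-block-< j k<m+1)) (ℕ.*-monoʳ-≤ (p ℕ.^ j)
                                           (s≤s (a₀-mono (ℕ.<⇒≤ (ℕ.<-≤-trans m<s (ℕ.≤-reflexive (ℕ.*-identityˡ s)))))))) ⟩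
      ι (p ℕ.^ j ℕ.* B)               ≡⟨ trans (ι-* (p ℕ.^ j) B) (*-comm (ι (p ℕ.^ j)) (ι B)) ⟩
      ι B * ι (p ℕ.^ j)               ≤⟨ *-monoˡ-≤-nonNeg (ι B) {{nonNegative (0≤ι B)}} (<⇒≤ p^j<u) ⟩
      ι B * u                         ∎)))
      where
      p^j<u : ι (p ℕ.^ j) < u
      p^j<u = upper-pow-≥ α 0<α (1≤ι (suc k)) (λ i n α<i/n → begin
        ι (p ℕ.^ j) ^ suc n                    ≡⟨ *-identityʳ (ι (p ℕ.^ j) ^ suc n) ⟨
        ι (p ℕ.^ j) ^ suc n * 1ℚ               ≤⟨ *-monoˡ-≤-nonNeg (ι (p ℕ.^ j) ^ suc n) {{nonNegative (^-nonNeg (suc n) (0≤ι (p ℕ.^ j)))}}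
                                                    (^-mono-exponent {i = 0} {i} (1≤ι (suc m)) z≤n) ⟩
        ι (p ℕ.^ j) ^ suc n * ι (suc m) ^ i    ≤⟨ pow-block-≥′ j m≤k i n α<i/n ⟩
        ι (suc k) ^ i                          ∎) upper-u

    c-< : ∀ k → Upper (c k) (ι B + 1ℚ)
    c-< k = [ (λ l → let r , B<r , l′ = lower-open (c k) l in contradiction (<-≤-trans B<r (c-≤ k l′)) (<-irrefl refl)) , id ]′
      (located (c k) (p<p+q (ι B) (positive⁻¹ 1ℚ)))

    -- A factor (1 + 1/n)^K, with n = k + 1, changes a term by at most ε, because
    -- (1 + 1/n)^K ≤ 1/(1 - K/n) and the terms are at most B.
    Fine : ℚ → ℕ → Set
    Fine ε k = 0ℚ < 1ℚ - ι K * frac 1 k × ι B * (ι K * frac 1 k) ≤ ε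

    eventually-fine : ∀ ε → 0ℚ < ε → ∃[ N ] ∀ k → N ℕ.≤ k → Fine ε k
    -- k ≥ K keeps 1 - K/(k + 1) positive; k ≥ N brings B K/(k + 1) down to ε.
    eventually-fine ε 0<ε = N ℕ.⊔ K , λ k N⊔K≤k →
      0<q-p {ι K * frac 1 k} {1ℚ} (*-cancelʳ-<-nonNeg (ι (suc k)) {{nonNegative (0≤ι (suc k))}} (begin-strict
        ι K * frac 1 k * ι (suc k)            ≡⟨ cancel (ι K) k ⟩
        ι K                                   <⟨ frac-mono-< (ℕ.*-monoˡ-< 1 (s≤s (ℕ.≤-trans (ℕ.m≤n⊔m N K) N⊔K≤k))) ⟩
        ι (suc k)                             ≡⟨ *-identityˡ (ι (suc k)) ⟨
        1ℚ * ι (suc k)                        ∎)) ,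
      *-cancelʳ-≤-pos (ι (suc k)) {{positive (0<ι-suc k)}} (begin
        ι B * (ι K * frac 1 k) * ι (suc k)    ≡⟨ cong (_* ι (suc k)) (*-assoc (ι B) (ι K) (frac 1 k)) ⟨
        ι B * ι K * frac 1 k * ι (suc k)      ≡⟨ cancel (ι B * ι K) k ⟩
        ι B * ι K                             ≤⟨ proj₂ (archimedean-* (ι B * ι K) 0<ε) ⟩
        ι (suc N) * ε                         ≤⟨ *-monoʳ-≤-nonNeg ε {{nonNegative (<⇒≤ 0<ε)}} (ι-mono-≤ (s≤s (ℕ.≤-trans (ℕ.m≤m⊔n N K) N⊔K≤k))) ⟩
        ι (suc k) * ε                         ≡⟨ *-comm (ι (suc k)) ε ⟩
        ε * ι (suc k)                         ∎)
      where
      N = proj₁ (archimedean-* (ι B * ι K) 0<ε)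
      cancel : ∀ x k → x * frac 1 k * ι (suc k) ≡ x
      cancel x k = trans (*-assoc x (frac 1 k) (ι (suc k)))
        (trans (cong (x *_) (trans (frac-ι 1 k) ι-one)) (*-identityʳ x))

    1/p^-≤ : ∀ j {m n} → m ℕ.≤ p ℕ.^ j ℕ.* n → 1/p^ j * ι m ≤ ι n
    1/p^-≤ j {m} {n} m≤ = begin
      1/p^ j * ι m                      ≤⟨ *-monoˡ-≤-nonNeg (1/p^ j) {{nonNegative (<⇒≤ (0<recip _ (0<ιp^ j)))}} (ι-mono-≤ m≤) ⟩
      1/p^ j * ι (p ℕ.^ j ℕ.* n)        ≡⟨ cong (1/p^ j *_) (trans (ι-* (p ℕ.^ j) n) (*-comm (ι (p ℕ.^ j)) (ι n))) ⟩
      1/p^ j * (ι n * ι (p ℕ.^ j))      ≡⟨ trans (sym (*-assoc (1/p^ j) (ι n) (ι (p ℕ.^ j)))) (cong (_* ι (p ℕ.^ j)) (*-comm (1/p^ j) (ι n))) ⟩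
      ι n * 1/p^ j * ι (p ℕ.^ j)        ≡⟨ recip-cancel (ι n) (ι (p ℕ.^ j)) (0<ιp^ j) ⟩
      ι n                               ∎

    -- The hypotheses on ρ amount to c m ≤ `growth k` · c n. The factor κ = 1 - K/(k + 1) undoes the
    -- growth, and κ q ≥ q - B K/(k + 1) ≥ q - ε since q ≤ B. The index k only sets the size of the
    -- error.
    c-compare : ∀ {ε k} → Fine ε k → ∀ {ρ m n} → 0ℚ < ρ → P n ≤[ ρ ] P m → ρ * ι (a₀ (suc m)) ≤ growth k * ι (a₀ (suc n)) →
                c m ≤ᴿ c n ⊕ ε
    c-compare {ε} {k} (0<κ , Bd≤ε) {ρ} {m} {n} 0<ρ P≤ ρa≤ {q} l =
      quotient-compare {a₀ (suc m)} {a₀ (suc n)} {P m} {P n} (0<pow (ι (suc m)) (1≤ι (suc m)) α 0<α) (0<pow (ι (suc n)) (1≤ι (suc n)) α 0<α) 0<ρ P≤ 0<κ (begin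
        κ * (ρ * ι (a₀ (suc m)))          ≤⟨ *-monoˡ-≤-nonNeg κ {{nonNegative (<⇒≤ 0<κ)}} ρa≤ ⟩
        κ * (growth k * ι (a₀ (suc n)))   ≡⟨ *-assoc κ (growth k) (ι (a₀ (suc n))) ⟨
        κ * growth k * ι (a₀ (suc n))     ≤⟨ *-monoʳ-≤-nonNeg (ι (a₀ (suc n))) {{nonNegative (0≤ι (a₀ (suc n)))}} ([1-kd][1+d]^k≤1 (0≤frac 1 k) K) ⟩
        1ℚ * ι (a₀ (suc n))               ≡⟨ *-identityˡ (ι (a₀ (suc n))) ⟩
        ι (a₀ (suc n))                    ∎)
        (begin
        q - ε                            ≤⟨ +-monoʳ-≤ q (neg-antimono-≤ Bd≤ε) ⟩
        q - ι B * d                      ≤⟨ +-monoʳ-≤ q (neg-antimono-≤ (*-monoʳ-≤-nonNeg d {{nonNegative 0≤d}} (c-≤ m l))) ⟩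
        q - q * d                        ≡⟨ solve 2 (λ q d → q :- q :* d := (con 1ℚ :- d) :* q) refl q d ⟩
        κ * q                            ∎) l
      where
      d = ι K * frac 1 k
      κ = 1ℚ - d
      0≤d : 0ℚ ≤ d
      0≤d = *-mono-≤-nonNeg {0ℚ} {_} {0ℚ} ≤-refl ≤-refl (0≤ι K) (0≤frac 1 k)

    -- Across the block a is at least p^j times its value at the prefix n, and the denominator at
    -- most p^j (n + 1)^α. The right end is included: with j = 0 it is n + 1, which yields the slow
    -- decrease.
    prefix-≤ : ∀ {ε k} → Fine ε k → ∀ j {l} → s ℕ.^ j ℕ.* suc k ℕ.≤ suc l → suc l ℕ.≤ s ℕ.^ j ℕ.* suc (suc k) →
               c k ≤ᴿ c l ⊕ ε
    prefix-≤ {ε} {k} fine j {l} k≤l l≤k+1 = c-compare {ε} {k} fine {m = k} {l} (*-pos (0<ιp^ j) (0<growth k))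
      (≤[]-trans (pow-block-≤ j l≤k+1) (pow-suc k)) (begin
        ι (p ℕ.^ j) * growth k * ι (a₀ (suc k))       ≡⟨ solve 3 (λ x g y → x :* g :* y := g :* (x :* y)) refl (ι (p ℕ.^ j)) (growth k) (ι (a₀ (suc k))) ⟩
        growth k * (ι (p ℕ.^ j) * ι (a₀ (suc k)))     ≡⟨ cong (growth k *_) (ι-* (p ℕ.^ j) (a₀ (suc k))) ⟨
        growth k * ι (p ℕ.^ j ℕ.* a₀ (suc k))         ≤⟨ *-monoˡ-≤-nonNeg (growth k) {{nonNegative (<⇒≤ (0<growth k))}}
                                                          (ι-mono-≤ (ℕ.≤-trans (a₀-block-≥ j (suc k)) (a₀-mono k≤l))) ⟩
        growth k * ι (a₀ (suc l))                     ∎)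

    -- Within the block of n, a stays below p^j (a_n + 1), and a_n ≥ n bounds a_n + 1 by (1 + 1/n)
    -- a_n.
    prefix-≥ : ∀ {ε k} → Fine ε k → ∀ j {l} → s ℕ.^ j ℕ.* suc k ℕ.≤ suc l → suc l ℕ.< s ℕ.^ j ℕ.* suc (suc k) →
               c l ≤ᴿ c k ⊕ ε
    prefix-≥ {ε} {k} fine j {l} k≤l l<k+1 = c-compare {ε} {k} fine {m = l} {k} (0<recip _ (0<ιp^ j)) (pow-block-≥ j k≤l) (begin
      1/p^ j * ι (a₀ (suc l))                   ≤⟨ 1/p^-≤ j (ℕ.<⇒≤ (a₀-block-< j l<k+1)) ⟩
      ι (suc (a₀ (suc k)))                      ≡⟨ ι-suc (a₀ (suc k)) ⟩
      1ℚ + aₖ                                    ≤⟨ +-monoˡ-≤ aₖ 1≤aₖ/k ⟩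
      frac 1 k * aₖ + aₖ                          ≡⟨ solve 2 (λ f a → f :* a :+ a := (con 1ℚ :+ f) :* con 1ℚ :* a) refl (frac 1 k) aₖ ⟩
      (1ℚ + frac 1 k) ^ 1 * aₖ                   ≤⟨ *-monoʳ-≤-nonNeg aₖ {{nonNegative (0≤ι (a₀ (suc k)))}} (^-mono-exponent {i = 1} {K} (1≤1+frac k) (s≤s z≤n)) ⟩
      growth k * aₖ                              ∎)
      where
      aₖ = ι (a₀ (suc k))
      1≤aₖ/k : 1ℚ ≤ frac 1 k * aₖ
      1≤aₖ/k = begin
        1ℚ                       ≡⟨ trans (frac-ι 1 k) ι-one ⟨
        frac 1 k * ι (suc k)     ≤⟨ *-monoˡ-≤-nonNeg (frac 1 k) {{nonNegative (0≤frac 1 k)}} (ι-mono-≤ (n≤a₀ (suc k))) ⟩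
        frac 1 k * aₖ             ∎

    -- c l is the term just before the multiple s^j (k + 1). Its numerator is below p^j (a_k + 1),
    -- with a_0 = 0, hence below p^j a_{k+1}; `growth l` pays for its smaller denominator.
    below-multiple-≤ : ∀ {ε l} → Fine ε l → ∀ j k → suc (suc l) ≡ s ℕ.^ j ℕ.* suc k → c l ≤ᴿ c k ⊕ ε
    below-multiple-≤ {ε} {l} fine j k eq = c-compare {ε} {l} fine {m = l} {k}
      (*-pos (0<recip _ (0<ιp^ j)) (0<growth l))
      (≤[]-trans (pow-block-≥ j (ℕ.≤-reflexive (sym eq))) (pow-suc l)) (begin
        1/p^ j * growth l * ι (a₀ (suc l))       ≡⟨ solve 3 (λ x g y → x :* g :* y := g :* (x :* y)) refl (1/p^ j) (growth l) (ι (a₀ (suc l))) ⟩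
        growth l * (1/p^ j * ι (a₀ (suc l)))     ≤⟨ *-monoˡ-≤-nonNeg (growth l) {{nonNegative (<⇒≤ (0<growth l))}} (1/p^-≤ j
                                                      (ℕ.≤-trans (ℕ.<⇒≤ (a₀-block-< j (ℕ.≤-reflexive eq))) (ℕ.*-monoʳ-≤ (p ℕ.^ j) (a₀-step k)))) ⟩
        growth l * ι (a₀ (suc k))                ∎)

    multiple-≥ : ∀ {ε} → 0ℚ < ε → ∀ j k l → suc l ≡ s ℕ.^ j ℕ.* suc k → c k ≤ᴿ c l ⊕ ε
    -- Any fine index N serves for the error here, because `growth N` ≥ 1.
    multiple-≥ {ε} 0<ε j k l eq = c-compare {ε} {N} (proj₂ (eventually-fine ε 0<ε) N ℕ.≤-refl) {m = k} {l}
      (0<ιp^ j) (pow-block-≤ j (ℕ.≤-reflexive eq)) (begin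
        ι (p ℕ.^ j) * ι (a₀ (suc k))      ≡⟨ ι-* (p ℕ.^ j) (a₀ (suc k)) ⟨
        ι (p ℕ.^ j ℕ.* a₀ (suc k))        ≤⟨ ι-mono-≤ (ℕ.≤-trans (a₀-block-≥ j (suc k)) (ℕ.≤-reflexive (cong a₀ (sym eq)))) ⟩
        ι (a₀ (suc l))                    ≡⟨ *-identityˡ (ι (a₀ (suc l))) ⟨
        1ℚ * ι (a₀ (suc l))               ≤⟨ *-monoʳ-≤-nonNeg (ι (a₀ (suc l))) {{nonNegative (0≤ι (a₀ (suc l)))}} (1≤growth N) ⟩
        growth N * ι (a₀ (suc l))         ∎)
      where
      N = proj₁ (eventually-fine ε 0<ε)

    ≤⊕ : ∀ k {ε} → 0ℚ < ε → c k ≤ᴿ c k ⊕ ε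
    ≤⊕ k 0<ε {q} = lower-closed (c k) (p-q<p q 0<ε)

    -- Each late term is compared with its prefix in [N + 1 , (N + 1) s), which is long enough to be
    -- fine; earlier terms represent themselves.
    net : ∀ ε → 0ℚ < ε → ∃[ N ] ∀ k → ∃[ j ] j ℕ.< N × c j ≤ᴿ c k ⊕ ε × c k ≤ᴿ c j ⊕ ε
    net ε 0<ε = suc N ℕ.* s , close
      where
      N = proj₁ (eventually-fine ε 0<ε)
      close : ∀ k → ∃[ j ] j ℕ.< suc N ℕ.* s × c j ≤ᴿ c k ⊕ ε × c k ≤ᴿ c j ⊕ ε
      close k with k ℕ.<? suc N ℕ.* s
      ... | yes k< = k , k< , ≤⊕ k 0<ε , ≤⊕ k 0<ε
      ... | no  k≮ with block-prefix s 2≤s (suc N) (suc k)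
                          (ℕ.≤-trans (ℕ.m≤m*n (suc N) s) (ℕ.m≤n⇒m≤1+n (ℕ.≮⇒≥ k≮)))
      ... | j , suc m , N<m , m<Ns , m≤k , k<m+1 = m , ℕ.<⇒≤ m<Ns ,
        prefix-≤ {ε} {m} fine j m≤k (ℕ.<⇒≤ k<m+1) , prefix-≥ {ε} {m} fine j m≤k k<m+1
        where fine = proj₂ (eventually-fine ε 0<ε) m (ℕ.s≤s⁻¹ N<m)

    -- Two below the multiple is the shifted index of the term preceding it. The exponent 2 + K
    -- leaves room for this, since s^(2+K) > 2 + K.
    large-multiple : ∀ K k → ∃[ l ] K ℕ.≤ l × suc (suc l) ≡ s ℕ.^ (2 ℕ.+ K) ℕ.* suc k
    large-multiple K k = l , ℕ.s≤s⁻¹ (ℕ.s≤s⁻¹ (ℕ.≤-trans 2+K≤ (ℕ.≤-reflexive (sym eq)))) , eq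
      where
      l = (s ℕ.^ (2 ℕ.+ K) ℕ.* suc k) ℕ.∸ 2
      2+K≤ : 2 ℕ.+ K ℕ.≤ s ℕ.^ (2 ℕ.+ K) ℕ.* suc k
      2+K≤ = ℕ.≤-trans (ℕ.<⇒≤ (n<m^n 2≤s (2 ℕ.+ K))) (ℕ.m≤m*n (s ℕ.^ (2 ℕ.+ K)) (suc k))
      eq : suc (suc l) ≡ s ℕ.^ (2 ℕ.+ K) ℕ.* suc k
      eq = ℕ.m+[n∸m]≡n (ℕ.≤-trans (ℕ.m≤m+n 2 K) 2+K≤)

    slowlyRecurrent : SlowlyRecurrent c
    slowlyRecurrent = record
      -- 0 is a weak lower bound; the cut asks for a strict one.
      { below         = - 1ℚ
      ; above         = ι B + 1ℚ
      ; below-lower   = λ k → let u , upper-u = upper-inhabited (P k) in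
          0ℚ , negative⁻¹ (- 1ℚ) , u , upper-u , ≤-trans (≤-reflexive (*-zeroˡ u)) (0≤ι (a₀ (suc k)))
      ; above-upper   = c-<
      ; slow-decrease = λ ε 0<ε → let N , fine = eventually-fine ε 0<ε in
          N , λ k N≤k → prefix-≤ {ε} {k} (fine k N≤k) 0
            (ℕ.≤-trans (ℕ.≤-reflexive (ℕ.*-identityˡ (suc k))) (ℕ.n≤1+n (suc k))) (ℕ.≤-reflexive (sym (ℕ.*-identityˡ (suc (suc k)))))
      ; net-below     = λ ε 0<ε → let N , close = net ε 0<ε in
          N , λ k → let j , j<N , cj≤ck , _ = close k in j , j<N , cj≤ck
      ; net-above     = λ ε 0<ε → let N , close = net ε 0<ε in
          N , λ k → let j , j<N , _ , ck≤cj = close k in j , j<N , ck≤cj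
      ; recurs-above  = λ ε 0<ε k K → let l , K≤l , eq = large-multiple K k in
          suc l , ℕ.m≤n⇒m≤1+n K≤l , multiple-≥ 0<ε (2 ℕ.+ K) k (suc l) eq
      ; recurs-below  = λ ε 0<ε k K → let N , fine = eventually-fine ε 0<ε ; l , KN≤l , eq = large-multiple (K ℕ.⊔ N) k in
          l , ℕ.≤-trans (ℕ.m≤m⊔n K N) KN≤l ,
          below-multiple-≤ {ε} {l} (fine l (ℕ.≤-trans (ℕ.m≤n⊔m K N) KN≤l)) (2 ℕ.+ (K ℕ.⊔ N)) k eq
      }

open import Data.Nat.Base using (ℕ; suc; _≤_; _<_; s≤s; NonZero)
open import Data.Fin.Base using (Fin)
open import Data.Fin.Subset using (Subset; _∈_; ∣_∣)
open import Data.Product.Base using (∃; ∃₂; _×_; _,_)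
open import Function.Bundles using (_⤖_; _⇔_; mk⇔)
open import Relation.Binary.PropositionalEquality using (_≡_)
open import Function.Base using (_∘_)
open RealSequences
open ValueSequence using (slowlyRecurrent)

theorem2 : (p s : ℕ) (3≤p : 3 ≤ p) (2≤s : 2 ≤ s) (s<p : s < p)
           (A : Subset p) (∣A∣≡s : ∣ A ∣ ≡ s)
           (h : Fin s ⤖ ∃ (_∈ A)) (h-increasing : StrictlyIncreasing h) →
           ∃₂ λ (m M : ℝ) →
             IsInfimum (b h 2≤s s<p) m ×
             IsSupremum (b h 2≤s s<p) M ×
             (∀ x → x ∈[ m , M ] → AccumulationPoint (b h 2≤s s<p) x) ×
             DenseIn (b h 2≤s s<p) m M ×
             (∀ x → AccumulationPoint (b h 2≤s s<p) x ⇔ x ∈[ m , M ])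
theorem2 p s 3≤p 2≤s s<p A ∣A∣≡s h h-increasing =
  infimum slow , supremum slow ,
  (m≤b , λ y y≤b → infimum-greatest slow y λ k → y≤b (suc k)) ,
  (b≤M , λ y b≤y → supremum-least slow y λ k → b≤y (suc k)) ,
  accumulation ,
  ((λ n → m≤b n , b≤M n) , λ x x∈ ε 0<ε → let k , _ , close = near slow x x∈ ε 0<ε 0 in suc k , _ , close) ,
  λ x → mk⇔
    (λ (ν , _ , ν>0 , lim) → limit∈ {λ k → b h 2≤s s<p (ν k) {{ν>0 k}}} {infimum slow} {supremum slow} {x}
      (λ k → m≤b (ν k) {{ν>0 k}} , b≤M (ν k) {{ν>0 k}}) lim)
    (accumulation x)
  where
  slow = slowlyRecurrent 2≤s s<p h h-increasing

  m≤b : ∀ n .{{_ : NonZero n}} → infimum slow ≤ᴿ b h 2≤s s<p n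
  m≤b (suc k) = infimum≤ slow k

  b≤M : ∀ n .{{_ : NonZero n}} → b h 2≤s s<p n ≤ᴿ supremum slow
  b≤M (suc k) = ≤supremum slow k

  accumulation : ∀ x → x ∈[ infimum slow , supremum slow ] → AccumulationPoint (b h 2≤s s<p) x
  accumulation x x∈ = let ν , increasing , lim = accumulates slow x x∈ in
    -- The successor undoes the index shift of `c` and makes every index nonzero.
    suc ∘ ν , s≤s ∘ increasing , (λ _ → _) , lim
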